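{- Let $p$ be a pattern on the variables $x$ and $y$, and let $P=\{xxyyx, xyxyx, xxxyxy, xxxyyx, xxxyyy, xxyxxy, xxyxyy, xxyyyx, xyxxxy, xyxxyx, xyxyyx\}$. (a) If $p$ is equivalent to a factor of $xyx$, then $\lambda_\simeq(p)=\infty$. (b) If $p$ has a factor equivalent to $xxxx$ or to some pattern in $P$, then $\lambda_\simeq(p)=2$. (c) Otherwise, $\lambda_\simeq(p)=3$.
   Context: Patterns are words over variables. Two patterns $p,q$ on $\{x,y\}$ are equivalent if $q\in\{p,\overline{p},p^R,\overline{p}^R\}$, where $\overline{p}$ is the image of $p$ under the morphism $x\mapsto y$, $y\mapsto x$, and $p^R$ is the reversal of $p$. For words, $u\simeq u'$ iff $u'\in\{u,u^R\}$. A word $w$ encounters a pattern $p=p_1\cdots p_n$ up to $\simeq$ if it has a factor $X_1\cdots X_n$ with all $X_i$ nonempty and $X_i\simeq X_j$ whenever $p_i=p_j$; otherwise it avoids $p$ up to $\simeq$. The undirected avoidability index $\lambda_\simeq(p)$ is the least positive integer $k$ such that some infinite word over a $k$-letter alphabet avoids $p$ up to $\simeq$, or $\infty$ if none exists. -}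

module Defs where

open import Data.Nat using (ℕ; _+_; _≤_; _<_)
open import Data.Fin using (Fin; toℕ)
open import Data.Bool using (Bool)
open import Data.List using (List; []; _∷_; _++_; reverse; map; length; lookup; tabulate; concat)
open import Data.List.Membership.Propositional using (_∈_)
open import Data.Maybe using (Maybe; just; nothing)
open import Data.Product using (Σ; ∃; _×_; Σ-syntax; ∃-syntax)
open import Data.Sum using (_⊎_)
open import Relation.Nullary using (¬_)
open import Relation.Binary.PropositionalEquality using (_≡_; _≢_)

data Var : Set where
  x y : Var

Pattern : Set
Pattern = List Var

swapV : Var → Var
swapV x = y
swapV y = x

bar : Pattern → Pattern
bar = map swapV

_≈P_ : Pattern → Pattern → Set
p ≈P q = (q ≡ p) ⊎ (q ≡ bar p) ⊎ (q ≡ reverse p) ⊎ (q ≡ reverse (bar p))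

IsFactor : {A : Set} → List A → List A → Set
IsFactor {A} u v = Σ[ a ∈ List A ] Σ[ b ∈ List A ] (a ++ u ++ b ≡ v)

_≃_ : {A : Set} → List A → List A → Set
u ≃ u' = (u' ≡ u) ⊎ (u' ≡ reverse u)

InfWord : Set → Set
InfWord A = ℕ → A

factorAt : {A : Set} → InfWord A → ℕ → ℕ → List A
factorAt w i n = tabulate {n = n} (λ j → w (i + toℕ j))

IsFactorInf : {A : Set} → List A → InfWord A → Set
IsFactorInf u w = Σ[ i ∈ ℕ ] (u ≡ factorAt w i (length u))

Encounters : {A : Set} → InfWord A → Pattern → Set
Encounters {A} w p =
  Σ[ X ∈ (Fin (length p) → List A) ]
    ((∀ i → X i ≢ [])
    × (∀ i j → lookup p i ≡ lookup p j → X i ≃ X j)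
    × IsFactorInf (concat (tabulate X)) w)

Avoids : {A : Set} → InfWord A → Pattern → Set
Avoids w p = ¬ Encounters w p

AvoidableOver : ℕ → Pattern → Set
AvoidableOver k p = Σ[ w ∈ InfWord (Fin k) ] Avoids w p

-- λ_≃(p) = n  (just n) or ∞ (nothing)
LambdaIs : Pattern → Maybe ℕ → Set
LambdaIs p nothing  = ∀ k → 1 ≤ k → ¬ AvoidableOver k p
LambdaIs p (just n) = (1 ≤ n) × AvoidableOver n p × (∀ k → 1 ≤ k → k < n → ¬ AvoidableOver k p)

xyx : Pattern
xyx = x ∷ y ∷ x ∷ []

xxxx : Pattern
xxxx = x ∷ x ∷ x ∷ x ∷ []

P : List Pattern
P = (x ∷ x ∷ y ∷ y ∷ x ∷ [])
  ∷ (x ∷ y ∷ x ∷ y ∷ x ∷ [])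
  ∷ (x ∷ x ∷ x ∷ y ∷ x ∷ y ∷ [])
  ∷ (x ∷ x ∷ x ∷ y ∷ y ∷ x ∷ [])
  ∷ (x ∷ x ∷ x ∷ y ∷ y ∷ y ∷ [])
  ∷ (x ∷ x ∷ y ∷ x ∷ x ∷ y ∷ [])
  ∷ (x ∷ x ∷ y ∷ x ∷ y ∷ y ∷ [])
  ∷ (x ∷ x ∷ y ∷ y ∷ y ∷ x ∷ [])
  ∷ (x ∷ y ∷ x ∷ x ∷ x ∷ y ∷ [])
  ∷ (x ∷ y ∷ x ∷ x ∷ y ∷ x ∷ [])
  ∷ (x ∷ y ∷ x ∷ y ∷ y ∷ x ∷ [])
  ∷ []

CondA : Pattern → Set
CondA p = Σ[ f ∈ Pattern ] (IsFactor f xyx × (p ≈P f))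

CondB : Pattern → Set
CondB p = Σ[ f ∈ Pattern ] (IsFactor f p × Σ[ q ∈ Pattern ] ((q ∈ (xxxx ∷ P)) × (f ≈P q)))

-- The words avoiding a pattern up to ≃ are images w of Dejean's ternary word t, all of whose factors have exponent at
-- most 7/4, under uniform substitutions. Long factors of w do not occur reversed, so long blocks that are equivalent up
-- to ≃ are equal; and a long repetition in w has a period that is a multiple of the width of the substitution, hence
-- comes from a repetition in t. So w has no large squares or near-squares. An encounter of a pattern in P, or of xyxy,
-- contains a square or near-square for each variable, so its blocks are short and finitely many factors of w remain to
-- be inspected. For xx, t itself will do, since XXᴿ contains the square of a letter.
--
-- A pattern with no factor as in (b) is, up to equivalence, a factor of xxxyy, xxyxy, xyxxy, xyyyx or xxxyxxx.
-- Backtracking shows that long binary words encounter the first four. A binary word of length 10 encounters xxx with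
-- blocks of length at most 3, so by the pigeonhole principle two distant encounters have the same X, and the factor
-- between them serves as y in xxxyxxx.
module Submission where

open import Defs
open import Data.Bool using (Bool; true; false; _∧_; _∨_; not)
open import Data.Bool.ListAction using (any; all)
open import Data.Empty using (⊥; ⊥-elim)
open import Data.Fin using (Fin; zero; suc; toℕ; fromℕ<)
import Data.Fin.Properties as Fin
open import Data.List using (List; []; _∷_; _++_; reverse; map; length; lookup; tabulate; concat; concatMap; upTo; replicate; take; drop; foldr; cartesianProductWith)
open import Data.List.Membership.Propositional using (_∈_; find)
open import Data.List.Membership.Propositional.Properties using (∈-cartesianProductWith⁺; ∈-map⁺; ∈-upTo⁺; ∈-++⁺ˡ; ∈-++⁺ʳ)
open import Data.List.Membership.Setoid.Properties using (index-injective)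
open import Data.List.Properties
open import Data.List.Relation.Binary.Infix.Heterogeneous using (Infix; MkView; toView; _ⁱ++_)
open import Data.List.Relation.Binary.Infix.Heterogeneous.Properties using (infix?)
open import Data.List.Relation.Binary.Pointwise using (Pointwise-≡⇒≡)
open import Data.List.Relation.Unary.All as All using (All; []; _∷_)
open import Data.List.Relation.Unary.Any as Any using (Any; here; there)
open import Data.Maybe using (Maybe; just; nothing; is-just)
open import Data.Nat using (ℕ; zero; suc; _+_; _*_; _∸_; _≤_; _<_; _<?_; _≤?_; z≤n; s≤s; _/_; _%_; _≡ᵇ_)
open import Data.Nat.DivMod
open import Data.Nat.Divisibility using (n∣m*n)
open import Data.Nat.Induction using (<-rec)
open import Data.Nat.Properties
open import Data.Product using (_×_; _,_; proj₁; proj₂; Σ-syntax; ∃-syntax; swap)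
open import Data.Sum using (_⊎_; inj₁; inj₂)
open import Data.Unit using (⊤; tt)
open import Data.Vec as Vec using (Vec; []; _∷_; toList)
open import Data.Vec.Properties using (length-toList)
open import Function using (_∘_)
open import Relation.Binary.PropositionalEquality
open import Relation.Nullary using (¬_; Dec; yes; no)
open import Relation.Nullary.Decidable using (True; toWitness; _→-dec_; _⊎-dec_)

-- Equivalence of patterns includes reversal, but an infinite word has no reversal. So every pattern
-- of the finite lists is paired with its reversal, both for avoidance and for unavoidability. The
-- choice of Dejean's word: if a factor of length q K ∸ Γ of the image recurs at distance q K, only
-- its full blocks can be pulled back, and up to two blocks are lost at its ends. This leaves a
-- factor of length q ∸ 2 of t that recurs at distance q, a repetition of exponent 2 - 2/q. It
-- exceeds 7/4 exactly when q > 8, so from period 9 on t excludes it for every substitution at once,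
-- and eight periods per substitution are left to evaluation. The slack Γ serves the variables that
-- a pattern does not square: their blocks recur only after a gap. All finite checks are evaluated
-- by the type checker. Hence they are Boolean functions with separate soundness lemmas, they run on
-- images of short factors of t, and facts once proved are made `abstract`.

private variable
  A : Set
  k : ℕ

-- Factors of infinite words; encounters with one representative per variable

fac : InfWord A → ℕ → ℕ → List A
fac w i zero    = []
fac w i (suc n) = w i ∷ fac w (suc i) n

factorAt≡fac : ∀ (w : InfWord A) i n → factorAt w i n ≡ fac w i n
factorAt≡fac w i zero    = refl
factorAt≡fac w i (suc n) = cong₂ _∷_ (cong w (+-identityʳ i))
  (trans (tabulate-cong (λ j → cong w (+-suc i (toℕ j)))) (factorAt≡fac w (suc i) n))

length-fac : ∀ (w : InfWord A) i n → length (fac w i n) ≡ n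
length-fac w i zero    = refl
length-fac w i (suc n) = cong suc (length-fac w (suc i) n)

infix 4 _at_within_

_at_within_ : List A → ℕ → InfWord A → Set
u at i within w = u ≡ fac w i (length u)

fac-at : ∀ (w : InfWord A) i n → fac w i n at i within w
fac-at w i n = cong (fac w i) (sym (length-fac w i n))

++-at⁻ : ∀ {w : InfWord A} u {v i} → u ++ v at i within w → (u at i within w) × (v at i + length u within w)
++-at⁻ {w = w} [] {v} {i} e rewrite +-identityʳ i = refl , e
++-at⁻ (a ∷ u) {i = i} e with ++-at⁻ u (∷-injectiveʳ e)
... | eu , ev rewrite +-suc i (length u) = cong₂ _∷_ (∷-injectiveˡ e) eu , ev

++-at⁺ : ∀ {w : InfWord A} u {v i} → u at i within w → v at i + length u within w → u ++ v at i within w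
++-at⁺ [] {i = i} eu ev rewrite +-identityʳ i = ev
++-at⁺ (a ∷ u) {i = i} eu ev rewrite +-suc i (length u) =
  cong₂ _∷_ (∷-injectiveˡ eu) (++-at⁺ u (∷-injectiveʳ eu) ev)

at-prefix : ∀ {w : InfWord A} {u v i} → u at i within w → v at i within w → length v ≤ length u → ∃[ s ] u ≡ v ++ s
at-prefix {u = u} {v = []} _ _ _ = u , refl
at-prefix {u = a ∷ u} {v = b ∷ v} eu ev (s≤s l) with at-prefix (∷-injectiveʳ eu) (∷-injectiveʳ ev) l
... | s , e = s , cong₂ _∷_ (trans (∷-injectiveˡ eu) (sym (∷-injectiveˡ ev))) e

≃-sym : {u v : List A} → u ≃ v → v ≃ u
≃-sym (inj₁ e) = inj₁ (sym e)
≃-sym {u = u} (inj₂ e) = inj₂ (trans (sym (reverse-involutive u)) (cong reverse (sym e)))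

≃-trans : {u v t : List A} → u ≃ v → v ≃ t → u ≃ t
≃-trans (inj₁ refl) f = f
≃-trans (inj₂ refl) (inj₁ refl) = inj₂ refl
≃-trans {u = u} (inj₂ refl) (inj₂ refl) = inj₁ (reverse-involutive u)

≃-length : {u v : List A} → u ≃ v → length v ≡ length u
≃-length (inj₁ refl) = refl
≃-length {u = u} (inj₂ refl) = length-reverse u

-- An encounter seen through one representative R v per variable.
data Match {A : Set} (w : InfWord A) (R : Var → List A) : Pattern → ℕ → Set where
  []    : ∀ {i} → Match w R [] i
  block : ∀ {v p i} B → R v ≃ B → B at i within w → Match w R p (i + length B) → Match w R (v ∷ p) i

Occurs : {A : Set} → InfWord A → Pattern → Set
Occurs {A} w p = Σ[ R ∈ (Var → List A) ] (∀ v → R v ≢ []) × ∃[ i ] Match w R p i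

_≟ᵛ_ : (u v : Var) → Dec (u ≡ v)
x ≟ᵛ x = yes refl
x ≟ᵛ y = no λ ()
y ≟ᵛ x = no λ ()
y ≟ᵛ y = yes refl

matchBlocks : ∀ {w : InfWord A} {R} p {i} (X : Fin (length p) → List A) →
              (∀ j → R (lookup p j) ≃ X j) → concat (tabulate X) at i within w → Match w R p i
matchBlocks [] X r e = []
matchBlocks (v ∷ p) X r e with ++-at⁻ (X zero) e
... | e₀ , e₁ = block (X zero) (r zero) e₀ (matchBlocks p (X ∘ suc) (r ∘ suc) e₁)

encounters⇒occurs : ∀ {w : InfWord A} {p} → Encounters w p → Occurs w p
encounters⇒occurs {A} {w} {p} (X , ne , sim , i , e) =
  proj₁ ∘ rep , (proj₁ ∘ proj₂) ∘ rep , i ,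
  matchBlocks p X (λ j → proj₂ (proj₂ (rep (lookup p j))) j refl) (trans e (factorAt≡fac w i _))
  where
  rep : ∀ v → Σ[ U ∈ List A ] (U ≢ []) × (∀ j → lookup p j ≡ v → U ≃ X j)
  rep v with Fin.any? (λ j → lookup p j ≟ᵛ v)
  ... | yes (j , eq) = X j , ne j , λ j′ eq′ → sim j j′ (trans eq (sym eq′))
  -- A variable absent from p still needs a nonempty representative; any letter will do.
  ... | no none      = w 0 ∷ [] , (λ ()) , λ j eq → ⊥-elim (none (j , eq))

matchBlocks⁻ : ∀ {w : InfWord A} {R p i} → (∀ v → R v ≢ []) → Match w R p i →
               Σ[ X ∈ (Fin (length p) → List A) ] (∀ j → X j ≢ []) × (∀ j → R (lookup p j) ≃ X j) × concat (tabulate X) at i within w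
matchBlocks⁻ ne [] = (λ ()) , (λ ()) , (λ ()) , refl
matchBlocks⁻ {R = R} ne (block {v} B r e m) with matchBlocks⁻ ne m
... | X , neX , rX , eX =
  (λ { zero → B ; (suc j) → X j }) ,
  (λ { zero → neB ; (suc j) → neX j }) ,
  (λ { zero → r ; (suc j) → rX j }) ,
  ++-at⁺ B e eX
  where
  neB : B ≢ []
  neB refl with R v | ne v | ≃-length r
  ... | [] | n | _ = n refl

occurs⇒encounters : ∀ {w : InfWord A} {p} → Occurs w p → Encounters w p
occurs⇒encounters {w = w} {p} (R , ne , i , m) with matchBlocks⁻ ne m
... | X , neX , rX , eX = X , neX ,
  (λ j j′ eq → ≃-trans (≃-sym (rX j)) (subst (λ v → R v ≃ X j′) (sym eq) (rX j′))) ,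
  i , trans eX (sym (factorAt≡fac w i _))

size : (Var → List A) → Pattern → ℕ
size R []      = 0
size R (v ∷ p) = length (R v) + size R p

match-++⁻ : ∀ {w : InfWord A} {R} p {q i} → Match w R (p ++ q) i → Match w R p i × Match w R q (i + size R p)
match-++⁻ [] {i = i} m rewrite +-identityʳ i = [] , m
match-++⁻ {R = R} (v ∷ p) {i = i} (block B r e m) with match-++⁻ p m
... | m₁ , m₂ = block B r e m₁ , subst (Match _ _ _) eq m₂
  where
  eq : i + length B + size R p ≡ i + (length (R v) + size R p)
  eq rewrite ≃-length r = +-assoc i (length (R v)) (size R p)

occurs-factor : ∀ {w : InfWord A} {f p} → IsFactor f p → Occurs w p → Occurs w f
occurs-factor (a , b , refl) (R , ne , i , m) =
  R , ne , _ , proj₁ (match-++⁻ _ {q = b} (proj₂ (match-++⁻ a m)))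

swapV-involutive : ∀ v → swapV (swapV v) ≡ v
swapV-involutive x = refl
swapV-involutive y = refl

match-bar : ∀ {w : InfWord A} {R} p {i} → Match w R (bar p) i → Match w (R ∘ swapV) p i
match-bar [] [] = []
match-bar (v ∷ p) (block B r e m) = block B r e (match-bar p m)

occurs-bar : ∀ {w : InfWord A} p → Occurs w (bar p) → Occurs w p
occurs-bar p (R , ne , i , m) = R ∘ swapV , ne ∘ swapV , i , match-bar p m

-- Backtracking search for occurrences, its soundness and completeness

_≡ᶠ_ : Fin k → Fin k → Bool
zero  ≡ᶠ zero  = true
zero  ≡ᶠ suc _ = false
suc _ ≡ᶠ zero  = false
suc i ≡ᶠ suc j = i ≡ᶠ j

≡ᶠ-sound : (i j : Fin k) → i ≡ᶠ j ≡ true → i ≡ j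
≡ᶠ-sound zero    zero    _ = refl
≡ᶠ-sound (suc i) (suc j) e = cong suc (≡ᶠ-sound i j e)

≡ᶠ-refl : (i : Fin k) → i ≡ᶠ i ≡ true
≡ᶠ-refl zero    = refl
≡ᶠ-refl (suc i) = ≡ᶠ-refl i

strip : List (Fin k) → List (Fin k) → Maybe (List (Fin k))
stripIf : Bool → List (Fin k) → List (Fin k) → Maybe (List (Fin k))
strip []      u       = just u
strip (_ ∷ _) []      = nothing
strip (a ∷ X) (b ∷ u) = stripIf (a ≡ᶠ b) X u
stripIf true  X u = strip X u
stripIf false X u = nothing

strip-sound : ∀ (X u : List (Fin k)) {v} → strip X u ≡ just v → u ≡ X ++ v
strip-sound []      u       refl = refl
strip-sound (a ∷ X) (b ∷ u) e with a ≡ᶠ b in ab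
... | true = cong₂ _∷_ (sym (≡ᶠ-sound a b ab)) (strip-sound X u e)

strip-++ : ∀ (X v : List (Fin k)) → strip X (X ++ v) ≡ just v
strip-++ []      v = refl
strip-++ (a ∷ X) v rewrite ≡ᶠ-refl a = strip-++ X v

-- X′ caches the mirror image of X (see `WfRef`), since every later block of the variable is
-- compared with both.
data Ref (k : ℕ) : Set where
  none : Ref k
  some : (X X′ : List (Fin k)) → Ref k

Cont : ℕ → Set
Cont k = List (Fin k) → Bool

-- Committing to X when it matches loses nothing: X and X′ have the same length, so if both are
-- prefixes they leave the same rest.
resume : Maybe (List (Fin k)) → Maybe (List (Fin k)) → Cont k → Bool
resume (just v) _        κ = κ v
resume nothing  (just v) κ = κ v
resume nothing  nothing  κ = false

-- The n letters of u read so far are kept in acc in reverse order, so that the mirror image of each prefix comes for free.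
anyPrefix : List Bool → List (Fin k) → ℕ → List (Fin k) → List (Fin k) → (List (Fin k) → List (Fin k) → Cont k) → Bool
anyPrefix []       u n acc v       κ = false
anyPrefix (b ∷ bs) u n acc []      κ = false
anyPrefix (b ∷ bs) u n acc (a ∷ v) κ = (b ∧ κ (take (suc n) u) (a ∷ acc) v) ∨ anyPrefix bs u (suc n) (a ∷ acc) v κ

-- Entry n of bx or by tells whether block length suc n is tried.
module Search (bx by : List Bool) where

  search : Pattern → Ref k → Ref k → Cont k
  search []      rx          ry          u = true
  search (x ∷ p) (some X X′) ry          u = resume (strip X u) (strip X′ u) (search p (some X X′) ry)
  search (x ∷ p) none        ry          u = anyPrefix bx u 0 [] u (λ X X′ → search p (some X X′) ry)
  search (y ∷ p) rx          (some Y Y′) u = resume (strip Y u) (strip Y′ u) (search p rx (some Y Y′))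
  search (y ∷ p) rx          none        u = anyPrefix by u 0 [] u (λ Y Y′ → search p rx (some Y Y′))

open Search public

∨-true : ∀ a {b} → a ∨ b ≡ true → (a ≡ true) ⊎ (b ≡ true)
∨-true true  _ = inj₁ refl
∨-true false e = inj₂ e

∧-true : ∀ a {b} → a ∧ b ≡ true → (a ≡ true) × (b ≡ true)
∧-true true e = refl , e

∨-true⁺ʳ : ∀ a {b} → b ≡ true → a ∨ b ≡ true
∨-true⁺ʳ true  _ = refl
∨-true⁺ʳ false e = e

resume-sound : ∀ (X X′ u : List (Fin k)) {κ} → X′ ≡ reverse X → resume (strip X u) (strip X′ u) κ ≡ true →
               ∃[ B ] ∃[ v ] (X ≃ B) × (u ≡ B ++ v) × (κ v ≡ true)
resume-sound X X′ u r e with strip X u in eq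
... | just v = X , v , inj₁ refl , strip-sound X u eq , e
... | nothing with strip X′ u in eq′
... | just v = X′ , v , inj₂ r , strip-sound X′ u eq′ , e

resume-complete : ∀ (X X′ B v : List (Fin k)) {κ} → X′ ≡ reverse X → X ≃ B → κ v ≡ true →
                  resume (strip X (B ++ v)) (strip X′ (B ++ v)) κ ≡ true
resume-complete X X′ B v r (inj₁ refl) e rewrite strip-++ X v = e
resume-complete X X′ B v {κ} refl (inj₂ refl) e with strip X (X′ ++ v) in eq
... | just v′ = subst (λ s → κ s ≡ true) (++-cancel-length X X′ (sym (strip-sound X (X′ ++ v) eq)) (length-reverse X)) e
  where
  ++-cancel-length : ∀ {A : Set} (a c : List A) {b d} → a ++ b ≡ c ++ d → length c ≡ length a → d ≡ b
  ++-cancel-length [] [] e _ = sym e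
  ++-cancel-length (_ ∷ a) (_ ∷ c) e l = ++-cancel-length a c (∷-injectiveʳ e) (suc-injective l)
... | nothing rewrite strip-++ X′ v = e

take-length-++ : ∀ {A : Set} (u v : List A) → take (length u) (u ++ v) ≡ u
take-length-++ []      v = refl
take-length-++ (a ∷ u) v = cong (a ∷_) (take-length-++ u v)

read : ∀ {A : Set} {u : List A} {n} acc {a v} → u ≡ reverse acc ++ a ∷ v → length acc ≡ n →
       (u ≡ reverse (a ∷ acc) ++ v) × (take (suc n) u ≡ reverse (a ∷ acc)) × (a ∷ acc ≡ reverse (take (suc n) u))
read {u = u} {n} acc {a} {v} e refl = eᵤ , eₜ , trans (sym (reverse-involutive (a ∷ acc))) (cong reverse (sym eₜ))
  where
  eᵤ : u ≡ reverse (a ∷ acc) ++ v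
  eᵤ = trans e (trans (sym (++-assoc (reverse acc) (a ∷ []) v)) (cong (_++ v) (sym (unfold-reverse a acc))))
  eₜ : take (suc (length acc)) u ≡ reverse (a ∷ acc)
  eₜ = trans (cong₂ take (sym (length-reverse (a ∷ acc))) eᵤ) (take-length-++ (reverse (a ∷ acc)) v)

anyPrefix-sound : ∀ bs {u : List (Fin k)} {n} acc v {κ} → u ≡ reverse acc ++ v → length acc ≡ n → anyPrefix bs u n acc v κ ≡ true →
                  ∃[ X ] ∃[ v′ ] (u ≡ X ++ v′) × (0 < length X) × (length X ≤ n + length bs) × (κ X (reverse X) v′ ≡ true)
anyPrefix-sound (b ∷ bs) {u} {n} acc (a ∷ v) {κ} e l f with read acc e l | ∨-true (b ∧ κ (take (suc n) u) (a ∷ acc) v) f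
... | eᵤ , eₜ , eᵣ | inj₁ g = take (suc n) u , v , trans eᵤ (cong (_++ v) (sym eₜ)) ,
      subst (0 <_) (sym len) (s≤s z≤n) , subst (_≤ n + suc (length bs)) (sym len) (≤-trans (s≤s (m≤m+n n (length bs))) (≤-reflexive (sym (+-suc n (length bs))))) ,
      trans (cong (λ X′ → κ (take (suc n) u) X′ v) (sym eᵣ)) (proj₂ (∧-true b g))
  where
  len : length (take (suc n) u) ≡ suc n
  len = trans (cong length eₜ) (trans (length-reverse (a ∷ acc)) (cong suc l))
... | eᵤ , eₜ , eᵣ | inj₂ g with anyPrefix-sound bs (a ∷ acc) v eᵤ (cong suc l) g
... | X , v′ , e′ , pos , le , f′ = X , v′ , e′ , pos , ≤-trans le (≤-reflexive (sym (+-suc n (length bs)))) , f′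

Allowed : List Bool → ℕ → Set
Allowed []       n       = ⊥
Allowed (b ∷ bs) zero    = b ≡ true
Allowed (b ∷ bs) (suc n) = Allowed bs n

anyPrefix-complete : ∀ bs {u : List (Fin k)} {n} acc B v {κ j} → u ≡ reverse acc ++ B ++ v → length acc ≡ n → length B ≡ suc j → Allowed bs j →
                     (∀ X → X ≡ reverse acc ++ B → κ X (reverse X) v ≡ true) → anyPrefix bs u n acc (B ++ v) κ ≡ true
anyPrefix-complete (b ∷ bs) {u} {n} acc (a ∷ []) v {κ} {zero} e l refl refl h with read acc e l
... | eᵤ , eₜ , eᵣ rewrite trans (cong (λ X′ → κ (take (suc n) u) X′ v) eᵣ) (h (take (suc n) u) (trans eₜ (unfold-reverse a acc))) = refl
anyPrefix-complete (b ∷ bs) {u} {n} acc (a ∷ B@(_ ∷ _)) v {κ} {suc j} e l lB al h with read acc e l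
... | eᵤ , eₜ , eᵣ = ∨-true⁺ʳ (b ∧ κ (take (suc n) u) (a ∷ acc) (B ++ v))
      (anyPrefix-complete bs (a ∷ acc) B v eᵤ (cong suc l) (suc-injective lB) al
        (λ X eX → h X (trans eX (trans (cong (_++ B) (unfold-reverse a acc)) (++-assoc (reverse acc) (a ∷ []) B)))))

Bounded : ℕ → List (Fin k) → Set
Bounded b U = (0 < length U) × (length U ≤ b)

nonempty : ∀ {k b} {U : List (Fin k)} → Bounded b U → U ≢ []
nonempty (() , _) refl

WfRef : ℕ → Ref k → Set
WfRef b none        = ⊤
WfRef b (some X X′) = Bounded b X × (X′ ≡ reverse X)

Agrees : Ref k → List (Fin k) → Set
Agrees none        U = ⊤
Agrees (some X X′) U = U ≡ X

-- The bound b is carried along for xxxyxxx, where the pigeonhole principle needs finitely many cube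
-- roots. `0 < b` admits the one-letter representative of a variable that has received no block.
search-sound : ∀ {bx by b} {w : InfWord (Fin k)} → 0 < b → length bx ≤ b → length by ≤ b →
               ∀ p rx ry u {i} → WfRef b rx → WfRef b ry → u at i within w → search bx by p rx ry u ≡ true →
               Σ[ R ∈ (Var → List (Fin k)) ] (∀ v → Bounded b (R v)) × Agrees rx (R x) × Agrees ry (R y) × Match w R p i
search-sound {k} {b = b} {w} b>0 ax ay [] rx ry u wx wy e s =
  R , bounded , agree rx , agree ry , []
  where
  pick : Ref k → List (Fin k)
  pick none       = w 0 ∷ []
  pick (some X _) = X
  R : Var → List (Fin k)
  R x = pick rx
  R y = pick ry
  pick-bounded : ∀ r → WfRef b r → Bounded b (pick r)
  pick-bounded none       _ = s≤s z≤n , b>0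
  pick-bounded (some _ _) (h , _) = h
  bounded : ∀ v → Bounded b (R v)
  bounded x = pick-bounded rx wx
  bounded y = pick-bounded ry wy
  agree : ∀ r → Agrees r (pick r)
  agree none       = tt
  agree (some _ _) = refl
search-sound b>0 ax ay (x ∷ p) (some X X′) ry u (wx , r) wy e s with resume-sound X X′ u r s
... | B , v , X≃B , refl , s′ with ++-at⁻ B e
... | e₁ , e₂ with search-sound b>0 ax ay p (some X X′) ry v (wx , r) wy e₂ s′
... | R , bd , refl , gy , m = R , bd , refl , gy , block B X≃B e₁ m
search-sound {bx = bx} b>0 ax ay (x ∷ p) none ry u wx wy e s with anyPrefix-sound bx [] u refl refl s
... | B , v , refl , pos , le , s′ with ++-at⁻ B e
... | e₁ , e₂ with search-sound b>0 ax ay p (some B (reverse B)) ry v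
                     ((pos , ≤-trans le ax) , refl) wy e₂ s′
... | R , bd , refl , gy , m = R , bd , tt , gy , block B (inj₁ refl) e₁ m
search-sound b>0 ax ay (y ∷ p) rx (some X X′) u wx (wy , r) e s with resume-sound X X′ u r s
... | B , v , X≃B , refl , s′ with ++-at⁻ B e
... | e₁ , e₂ with search-sound b>0 ax ay p rx (some X X′) v wx (wy , r) e₂ s′
... | R , bd , gx , refl , m = R , bd , gx , refl , block B X≃B e₁ m
search-sound {by = by} b>0 ax ay (y ∷ p) rx none u wx wy e s with anyPrefix-sound by [] u refl refl s
... | B , v , refl , pos , le , s′ with ++-at⁻ B e
... | e₁ , e₂ with search-sound b>0 ax ay p rx (some B (reverse B)) v wx
                     ((pos , ≤-trans le ay) , refl) e₂ s′
... | R , bd , gx , refl , m = R , bd , gx , tt , block B (inj₁ refl) e₁ m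

Listed : List Bool → List (Fin k) → Set
Listed bs U = ∃[ n ] Allowed bs n × (length U ≡ suc n)

Fits : Ref k → List (Fin k) → Set
Fits none        U = ⊤
Fits (some X X′) U = (X′ ≡ reverse X) × (U ≃ X)

at-split : ∀ {w : InfWord (Fin k)} {u B i m} → u at i within w → B at i within w → length B + m ≤ length u →
           ∃[ v ] (u ≡ B ++ v) × (v at i + length B within w) × (m ≤ length v)
at-split {B = B} eu eB l with at-prefix eu eB (≤-trans (m≤m+n _ _) l)
... | v , refl = v , refl , proj₂ (++-at⁻ B eu) , +-cancelˡ-≤ (length B) _ _ (subst (_ ≤_) (length-++ B) l)

-- Used contrapositively: a failed search on a window excludes every match with blocks of the listed
-- lengths. The bound on `size R p` keeps the match inside the window.
search-complete : ∀ {bx by} {w : InfWord (Fin k)} {R p i} → Listed bx (R x) → Listed by (R y) → Match w R p i →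
                  ∀ rx ry u → Fits rx (R x) → Fits ry (R y) → u at i within w → size R p ≤ length u →
                  search bx by p rx ry u ≡ true
search-complete hx hy [] rx ry u fx fy e l = refl
search-complete {bx = bx} {by} {R = R} {p = x ∷ p} hx hy (block B r eB m) rx ry u fx fy e l
  with at-split {m = size R p} e eB (subst (λ n → n + size R p ≤ length u) (sym (≃-length r)) l)
... | v , refl , ev , l′ with rx | fx
... | some X X′ | r′ , rX = resume-complete X X′ B v r′ (≃-trans (≃-sym rX) r)
                             (search-complete hx hy m (some X X′) ry v (r′ , rX) fy ev l′)
... | none | _ with hx
... | n , n∈ , ln = anyPrefix-complete bx [] B v {λ X X′ → search bx by p (some X X′) ry} refl refl (trans (≃-length r) ln) n∈
                      (λ { _ refl → search-complete {bx = bx} {by} hx hy m (some B (reverse B)) ry v (refl , r) fy ev l′ })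
search-complete {bx = bx} {by} {R = R} {p = y ∷ p} hx hy (block B r eB m) rx ry u fx fy e l
  with at-split {m = size R p} e eB (subst (λ n → n + size R p ≤ length u) (sym (≃-length r)) l)
... | v , refl , ev , l′ with ry | fy
... | some X X′ | r′ , rX = resume-complete X X′ B v r′ (≃-trans (≃-sym rX) r)
                             (search-complete hx hy m rx (some X X′) v fx (r′ , rX) ev l′)
... | none | _ with hy
... | n , n∈ , ln = anyPrefix-complete by [] B v {λ Y Y′ → search bx by p rx (some Y Y′)} refl refl (trans (≃-length r) ln) n∈
                      (λ { _ refl → search-complete {bx = bx} {by} hx hy m rx (some B (reverse B)) v fx (refl , r) ev l′ })

allowed : ℕ → List Bool
allowed n = replicate n true

-- Unavoidability over two letters

Letter : Set
Letter = Fin 2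

pattern O = zero
pattern I = suc zero

-- Words grow to the left, so that a new encounter is always a prefix.
tree : (List Letter → Bool) → ℕ → List Letter → Bool
tree found zero    u = found u
tree found (suc d) u = found u ∨ (tree found d (O ∷ u) ∧ tree found d (I ∷ u))

-- The root u stands d letters to the right of i and each level prepends the letter of w just before
-- it, so the tree never reads to the left of i.
tree-sound : ∀ found d u {i} {w : InfWord Letter} → tree found d u ≡ true → u at d + i within w →
             ∃[ j ] ∃[ v ] (i ≤ j) × (j ≤ d + i) × (v at j within w) × (found v ≡ true)
tree-sound found zero    u t e = _ , u , ≤-refl , ≤-refl , e , t
tree-sound found (suc d) u {i} {w} t e with ∨-true (found u) t
... | inj₁ f = _ , u , m≤n+m i (suc d) , ≤-refl , e , f
... | inj₂ t′ with ∧-true (tree found d (O ∷ u)) t′ | w (d + i) in eq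
... | t₀ , t₁ | O with tree-sound found d (O ∷ u) t₀ (cong₂ _∷_ (sym eq) e)
... | j , v , l , l′ , r = j , v , l , m≤n⇒m≤1+n l′ , r
tree-sound found (suc d) u {i} {w} t e | inj₂ t′ | t₀ , t₁ | I with tree-sound found d (I ∷ u) t₁ (cong₂ _∷_ (sym eq) e)
... | j , v , l , l′ , r = j , v , l , m≤n⇒m≤1+n l′ , r

all-true : ∀ {A : Set} (f : A → Bool) l → all f l ≡ true → All (λ a → f a ≡ true) l
all-true f []      _ = []
all-true f (a ∷ l) e with ∧-true (f a) e
... | e₁ , e₂ = e₁ ∷ all-true f l e₂

any-true : ∀ {A : Set} (f : A → Bool) l → any f l ≡ true → ∃[ a ] (a ∈ l) × (f a ≡ true)
any-true f (a ∷ l) e with ∨-true (f a) e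
... | inj₁ e₁ = a , here refl , e₁
... | inj₂ e₂ with any-true f l e₂
... | b , b∈ , eb = b , there b∈ , eb

is-just-true : ∀ {A : Set} (m : Maybe A) → is-just m ≡ true → ∃[ a ] m ≡ just a
is-just-true (just a) _ = a , refl

module Unavoidable (p : Pattern) (bx by : List Bool) where

  found : List Letter → Bool
  found = search bx by p none none

  startsWith : List (List Letter) → List Letter → Bool
  startsWith stops u = any (λ s → is-just (strip s u)) stops

  -- Stop words cut the search in two: first every long word contains p or a stop word,
  -- then p appears to the left of a stop word. This is much smaller than one tree for p alone.
  certificate : List (List Letter) → ℕ → ℕ → Bool
  certificate stops d d′ = tree (λ u → found u ∨ startsWith stops u) d [] ∧ all (tree found d′) stops

  Found : (b : ℕ) (w : InfWord Letter) (i j : ℕ) → Set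
  Found b w i j = ∃[ n ] (i ≤ n) × (n ≤ j) × Σ[ R ∈ (Var → List Letter) ] (∀ v → Bounded b (R v)) × Match w R p n

  certified : ∀ stops d d′ b → certificate stops d d′ ≡ true → 0 < b → length bx ≤ b → length by ≤ b →
              ∀ (w : InfWord Letter) i → Found b w i (d + (d′ + i))
  certified stops d d′ b c b>0 ax ay w i
    with ∧-true (tree (λ u → found u ∨ startsWith stops u) d []) c
  -- The first tree stops at d′ + i, so that d′ letters remain to the left of any stop word that it
  -- meets.
  ... | c₁ , c₂ with tree-sound (λ u → found u ∨ startsWith stops u) d [] {i = d′ + i} {w} c₁ refl
  ... | j , v , l , l′ , e , f with ∨-true (found v) f
  ... | inj₁ f₁ with search-sound b>0 ax ay p none none v tt tt e f₁
  ... | R , bd , _ , _ , m = j , m+n≤o⇒n≤o d′ l , l′ , R , bd , m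
  certified stops d d′ b c b>0 ax ay w i | c₁ , c₂ | j , v , l , l′ , e , f | inj₂ f₂
    with any-true (λ s → is-just (strip s v)) stops f₂
  ... | s , s∈ , st with is-just-true (strip s v) st
  ... | v′ , eq with strip-sound s v eq | m≤n⇒∃[o]m+o≡n l
  ... | refl | o , refl
    with tree-sound found d′ s {i = i + o} {w} (All.lookup (all-true (tree found d′) stops c₂) s∈)
           (subst (s at_within w) (+-assoc d′ i o) (proj₁ (++-at⁻ s e)))
  ... | j′ , u , k , k′ , e′ , f′ with search-sound b>0 ax ay p none none u tt tt e′ f′
  ... | R , bd , _ , _ , m =
    j′ , ≤-trans (m≤m+n i o) k , ≤-trans k′ (subst (_≤ d + (d′ + i)) (+-assoc d′ i o) l′) , R , bd , m

  unavoidable : ∀ stops d d′ → certificate stops d d′ ≡ true →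
                ∀ b {_ : True (0 <? b)} {_ : True (length bx ≤? b)} {_ : True (length by ≤? b)} →
                (w : InfWord Letter) → Occurs w p
  unavoidable stops d d′ c b {b>0} {ax} {ay} w
    with certified stops d d′ b c (toWitness b>0) (toWitness ax) (toWitness ay) w 0
  ... | n , _ , _ , R , bd , m = R , nonempty ∘ bd , n , m

-- Each direction of a pattern has its own certificate; the palindrome xyyyx serves for both. Stop
-- words come in complementary pairs, since exchanging the letters of a word preserves its
-- encounters.
xxxyy-unavoidable : (w : InfWord Letter) → Occurs w (x ∷ x ∷ x ∷ y ∷ y ∷ [])
xxxyy-unavoidable = Unavoidable.unavoidable _ (allowed 4) (allowed 10)
  ((O ∷ I ∷ O ∷ O ∷ []) ∷ (I ∷ O ∷ I ∷ I ∷ []) ∷ []) 11 26 refl 10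

yyxxx-unavoidable : (w : InfWord Letter) → Occurs w (y ∷ y ∷ x ∷ x ∷ x ∷ [])
yyxxx-unavoidable = Unavoidable.unavoidable _ (allowed 3) (allowed 10)
  ((O ∷ O ∷ O ∷ []) ∷ (I ∷ I ∷ I ∷ []) ∷ []) 14 24 refl 10

xxyxy-unavoidable : (w : InfWord Letter) → Occurs w (x ∷ x ∷ y ∷ x ∷ y ∷ [])
xxyxy-unavoidable = Unavoidable.unavoidable _ (allowed 4) (allowed 7)
  ((I ∷ I ∷ O ∷ O ∷ O ∷ []) ∷ (O ∷ O ∷ I ∷ I ∷ I ∷ []) ∷ []) 17 20 refl 7

yxyxx-unavoidable : (w : InfWord Letter) → Occurs w (y ∷ x ∷ y ∷ x ∷ x ∷ [])
yxyxx-unavoidable = Unavoidable.unavoidable _ (allowed 5) (allowed 7)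
  ((I ∷ I ∷ O ∷ O ∷ []) ∷ (O ∷ O ∷ I ∷ I ∷ []) ∷ []) 13 23 refl 7

xyyyx-unavoidable : (w : InfWord Letter) → Occurs w (x ∷ y ∷ y ∷ y ∷ x ∷ [])
xyyyx-unavoidable = Unavoidable.unavoidable _ (allowed 6) (allowed 3)
  ((I ∷ I ∷ O ∷ O ∷ []) ∷ (O ∷ O ∷ I ∷ I ∷ []) ∷ []) 21 22 refl 6

xyxxy-unavoidable : (w : InfWord Letter) → Occurs w (x ∷ y ∷ x ∷ x ∷ y ∷ [])
xyxxy-unavoidable = Unavoidable.unavoidable _ (allowed 4) (allowed 24)
  ((I ∷ I ∷ I ∷ I ∷ O ∷ []) ∷ (O ∷ O ∷ O ∷ O ∷ I ∷ []) ∷ []) 25 75 refl 24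

yxxyx-unavoidable : (w : InfWord Letter) → Occurs w (y ∷ x ∷ x ∷ y ∷ x ∷ [])
yxxyx-unavoidable = Unavoidable.unavoidable _ (allowed 3) (allowed 24)
  ((I ∷ I ∷ O ∷ I ∷ O ∷ []) ∷ (O ∷ O ∷ I ∷ O ∷ I ∷ []) ∷ []) 24 77 refl 24

words : {A : Set} → List A → ℕ → List (List A)
words as zero    = [] ∷ []
words as (suc n) = cartesianProductWith _∷_ as (words as n)

∈-words : ∀ {A : Set} {as : List A} → (∀ a → a ∈ as) → ∀ u → u ∈ words as (length u)
∈-words h []      = here refl
∈-words h (a ∷ u) = ∈-cartesianProductWith⁺ _∷_ (h a) (∈-words h u)

-- One letter; equivalent patterns; factors of xyx

unary-occurs : ∀ (w : InfWord (Fin 1)) p → Occurs w p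
unary-occurs w p = (λ _ → zero ∷ []) , (λ _ ()) , 0 , match p 0
  where
  match : ∀ p i → Match w (λ _ → zero ∷ []) p i
  match []      i = []
  match (v ∷ p) i with w i in eq
  ... | zero = block (zero ∷ []) (inj₁ refl) (cong (_∷ []) (sym eq)) (match p (i + 1))

bar-involutive : ∀ p → bar (bar p) ≡ p
bar-involutive []      = refl
bar-involutive (v ∷ p) = cong₂ _∷_ (swapV-involutive v) (bar-involutive p)

reverse-bar : ∀ p → reverse (bar p) ≡ bar (reverse p)
reverse-bar p = sym (reverse-map swapV p)

occurs-≈ : ∀ {A : Set} {w : InfWord A} {f p} → Occurs w f → Occurs w (reverse f) → f ≈P p → Occurs w p
occurs-≈ o r (inj₁ refl) = o
occurs-≈ {w = w} {f} o r (inj₂ (inj₁ refl)) = occurs-bar (bar f) (subst (Occurs w) (sym (bar-involutive f)) o)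
occurs-≈ o r (inj₂ (inj₂ (inj₁ refl))) = r
occurs-≈ {w = w} {f} o r (inj₂ (inj₂ (inj₂ refl))) =
  occurs-bar (reverse (bar f)) (subst (Occurs w) (sym eq) r)
  where
  eq : bar (reverse (bar f)) ≡ reverse f
  eq = trans (sym (reverse-bar (bar f))) (cong reverse (bar-involutive f))

≈P-sym : ∀ {p q} → p ≈P q → q ≈P p
≈P-sym (inj₁ refl) = inj₁ refl
≈P-sym {p} (inj₂ (inj₁ refl)) = inj₂ (inj₁ (sym (bar-involutive p)))
≈P-sym {p} (inj₂ (inj₂ (inj₁ refl))) = inj₂ (inj₂ (inj₁ (sym (reverse-involutive p))))
≈P-sym {p} (inj₂ (inj₂ (inj₂ refl))) = inj₂ (inj₂ (inj₂ (sym eq)))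
  where
  eq : reverse (bar (reverse (bar p))) ≡ p
  eq = trans (cong reverse (trans (sym (reverse-bar (bar p))) (cong reverse (bar-involutive p)))) (reverse-involutive p)

xyx-occurs : ∀ {k} (w : InfWord (Fin k)) → Occurs w xyx
-- Only even positions are sampled, so that at least one letter lies between two equal samples and y
-- is nonempty.
xyx-occurs {k} w with Fin.pigeonhole (n<1+n k) (λ i → w (2 * toℕ i))
... | i , j , i<j , eq with m≤n⇒∃[o]m+o≡n (*-monoʳ-≤ 2 i<j)
... | o , gap = R , ne , n , block _ (inj₁ refl) refl (block _ (inj₁ refl) (fac-at w (n + 1) (suc o))
                 (block _ (inj₁ refl) (cong (_∷ []) (trans eq (cong w (sym pos)))) []))
  where
  n = 2 * toℕ i
  R : Var → List (Fin k)
  R x = w n ∷ []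
  R y = fac w (n + 1) (suc o)
  ne : ∀ v → R v ≢ []
  ne x ()
  ne y ()
  pos : n + 1 + length (fac w (n + 1) (suc o)) ≡ 2 * toℕ j
  pos rewrite length-fac w (n + 1) (suc o) = begin
    n + 1 + suc o          ≡⟨ +-assoc n 1 (suc o) ⟩
    n + (2 + o)            ≡⟨ +-assoc n 2 o ⟨
    n + 2 + o              ≡⟨ cong (_+ o) (+-comm n 2) ⟩
    2 + n + o              ≡⟨ cong (_+ o) (*-suc 2 (toℕ i)) ⟨
    2 * suc (toℕ i) + o    ≡⟨ gap ⟩
    2 * toℕ j              ∎
    where open ≡-Reasoning

factor-reverse : ∀ {A : Set} {f p : List A} → IsFactor f p → IsFactor (reverse f) (reverse p)
factor-reverse {f = f} (a , b , refl) = reverse b , reverse a , sym eq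
  where
  eq : reverse (a ++ f ++ b) ≡ reverse b ++ reverse f ++ reverse a
  eq = trans (reverse-++ a (f ++ b)) (trans (cong (_++ reverse a) (reverse-++ f b)) (++-assoc (reverse b) (reverse f) (reverse a)))

condA-occurs : ∀ {k p} → CondA p → (w : InfWord (Fin k)) → Occurs w p
condA-occurs (f , fac , p≈f) w =
  occurs-≈ (occurs-factor fac (xyx-occurs w)) (occurs-factor (factor-reverse fac) (xyx-occurs w)) (≈P-sym p≈f)

-- Distant cubes and the pattern xxxyxxx

letters : List Letter
letters = O ∷ I ∷ []

∈-letters : (a : Letter) → a ∈ letters
∈-letters O = here refl
∈-letters I = there (here refl)

cubeRoots : List (List Letter)
cubeRoots = words letters 1 ++ words letters 2 ++ words letters 3

∈-cubeRoots : ∀ {U : List Letter} → Bounded 3 U → U ∈ cubeRoots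
∈-cubeRoots {a ∷ []}         _ = ∈-++⁺ˡ (∈-words ∈-letters (a ∷ []))
∈-cubeRoots {a ∷ b ∷ []}     _ = ∈-++⁺ʳ (words letters 1) (∈-++⁺ˡ (∈-words ∈-letters (a ∷ b ∷ [])))
∈-cubeRoots {a ∷ b ∷ c ∷ []} _ = ∈-++⁺ʳ (words letters 1) (∈-++⁺ʳ (words letters 2) (∈-words ∈-letters (a ∷ b ∷ c ∷ [])))
∈-cubeRoots {_ ∷ _ ∷ _ ∷ _ ∷ _} (_ , s≤s (s≤s (s≤s ())))
∈-cubeRoots {[]} (() , _)

xxx : Pattern
xxx = x ∷ x ∷ x ∷ []

-- The cubes are found before y is known; a match that involves x alone carries over to whatever
-- represents y later.
match-only : ∀ {A : Set} {w : InfWord A} {R R′ p i} → R x ≡ R′ x → All (x ≡_) p → Match w R p i → Match w R′ p i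
match-only e []          []              = []
match-only e (refl ∷ xs) (block B r a m) = block B (subst (_≃ B) e r) a (match-only e xs m)

match-++⁺ : ∀ {A : Set} {w : InfWord A} {R p q i} → Match w R p i → Match w R q (i + size R p) → Match w R (p ++ q) i
match-++⁺ {i = i} [] m′ = subst (Match _ _ _) (+-identityʳ i) m′
match-++⁺ {R = R} {p = v ∷ p} {i = i} (block B r e m) m′ = block B r e (match-++⁺ m (subst (Match _ _ _) (sym eq) m′))
  where
  eq : i + length B + size R p ≡ i + (length (R v) + size R p)
  eq rewrite ≃-length r = +-assoc i (length (R v)) (size R p)

module Cubes = Unavoidable xxx (allowed 3) []

cube : (w : InfWord Letter) (i : ℕ) → Cubes.Found 3 w i (10 + i)
cube = Cubes.certified [] 10 0 3 refl (s≤s z≤n) ≤-refl z≤n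

-- Cubes are sought from the positions 20 i. One starts at most 10 letters later and spans at most
-- 9, so it ends before 20 (i + 1) and leaves room for a nonempty y.
gap-between : ∀ {n n′ l} i j → i < j → n ≤ 10 + 20 * i → 20 * j ≤ n′ → l ≤ 3 → n + (l + (l + (l + 0))) < n′
gap-between {n} {n′} {l} i j i<j n≤ ≤n′ l≤3 = begin-strict
  n + (l + (l + (l + 0)))   ≤⟨ +-mono-≤ n≤ (+-mono-≤ l≤3 (+-mono-≤ l≤3 (+-monoˡ-≤ 0 l≤3))) ⟩
  10 + 20 * i + 9           ≡⟨ +-comm (10 + 20 * i) 9 ⟩
  19 + 20 * i               <⟨ n<1+n (19 + 20 * i) ⟩
  20 + 20 * i               ≡⟨ *-suc 20 i ⟨
  20 * suc i                ≤⟨ *-monoʳ-≤ 20 i<j ⟩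
  20 * j                    ≤⟨ ≤n′ ⟩
  n′                        ∎
  where open ≤-Reasoning

join-cubes : ∀ {w : InfWord Letter} {R R′ n n′} → R x ≢ [] → R x ≡ R′ x → Match w R xxx n → Match w R′ xxx n′ →
             n + size R xxx < n′ → Occurs w (xxx ++ y ∷ xxx)
join-cubes {w} {R} {R′} {n} {n′} neX R≡R′ m m′ far with m≤n⇒∃[o]m+o≡n far
... | o , gap = R″ , ne , n ,
  match-++⁺ {p = xxx} (match-only refl xs m)
    (block _ (inj₁ refl) (fac-at w _ (suc o)) (match-only (sym R≡R′) xs (subst (Match w R′ xxx) (sym pos) m′)))
  where
  R″ : Var → List Letter
  R″ x = R x
  R″ y = fac w (n + size R xxx) (suc o)
  ne : ∀ v → R″ v ≢ []
  ne x = neX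
  ne y ()
  xs : All (x ≡_) xxx
  xs = refl ∷ refl ∷ refl ∷ []
  pos : n + size R xxx + length (fac w (n + size R xxx) (suc o)) ≡ n′
  pos rewrite length-fac w (n + size R xxx) (suc o) = trans (+-suc (n + size R xxx) o) gap

-- The list of roots and the supply of cubes are variables here, so the pigeonhole argument cannot
-- unfold the concrete search.
cubes⇒occurs : ∀ {roots} {w : InfWord Letter} → (∀ {U} → Bounded 3 U → U ∈ roots) →
               (∀ i → Cubes.Found 3 w i (10 + i)) → Occurs w (xxx ++ y ∷ xxx)
cubes⇒occurs {roots} {w} ∈roots cube
  with Fin.pigeonhole (n<1+n (length roots)) (λ i → Any.index (∈root (toℕ i)))
  where
  root : ℕ → Var → List Letter
  root i = proj₁ (proj₂ (proj₂ (proj₂ (cube (20 * i)))))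
  ∈root : ∀ i → root i x ∈ roots
  ∈root i = ∈roots (proj₁ (proj₂ (proj₂ (proj₂ (proj₂ (cube (20 * i)))))) x)
... | i , j , i<j , eq = join (toℕ i) (toℕ j) i<j (index-injective (setoid _) _ _ eq)
  where
  join : ∀ i j → i < j → proj₁ (proj₂ (proj₂ (proj₂ (cube (20 * i))))) x ≡ proj₁ (proj₂ (proj₂ (proj₂ (cube (20 * j))))) x →
         Occurs w (xxx ++ y ∷ xxx)
  join i j i<j R≡R′ with cube (20 * i) | cube (20 * j)
  ... | n , _ , n≤ , R , bd , m | n′ , ≤n′ , _ , R′ , _ , m′ =
    join-cubes {n = n} (nonempty (bd x)) R≡R′ m m′ (gap-between i j i<j n≤ ≤n′ (proj₂ (bd x)))

xxxyxxx-unavoidable : (w : InfWord Letter) → Occurs w (xxx ++ y ∷ xxx)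
xxxyxxx-unavoidable w = cubes⇒occurs ∈-cubeRoots (cube w)

-- Classification of patterns

_⊑_ : Pattern → Pattern → Set
_⊑_ = Infix _≡_

_⊑?_ : ∀ f p → Dec (f ⊑ p)
_⊑?_ = infix? _≟ᵛ_

⊑⇒factor : ∀ {f p} → f ⊑ p → IsFactor f p
⊑⇒factor i with toView i
... | MkView a e b rewrite Pointwise-≡⇒≡ e = a , b , refl

variants : Pattern → List Pattern
variants p = p ∷ bar p ∷ reverse p ∷ reverse (bar p) ∷ []

∈-variants : ∀ {f p} → f ∈ variants p → p ≈P f
∈-variants (here e)                         = inj₁ e
∈-variants (there (here e))                 = inj₂ (inj₁ e)
∈-variants (there (there (here e)))         = inj₂ (inj₂ (inj₁ e))
∈-variants (there (there (there (here e)))) = inj₂ (inj₂ (inj₂ e))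

-- The maximal patterns, up to equivalence, that have no factor as in HasB.
maximal : List Pattern
maximal = (x ∷ x ∷ x ∷ y ∷ y ∷ []) ∷ (x ∷ x ∷ y ∷ x ∷ y ∷ []) ∷ (x ∷ y ∷ x ∷ x ∷ y ∷ [])
        ∷ (x ∷ y ∷ y ∷ y ∷ x ∷ []) ∷ (xxx ++ y ∷ xxx) ∷ []

minimalTernary : List Pattern
minimalTernary = (x ∷ x ∷ []) ∷ (x ∷ y ∷ x ∷ y ∷ []) ∷ []

-- The four equivalent patterns are enumerated, which makes each property decidable by evaluation on
-- all patterns of a given length.
HasB Below HasTernary IsA : Pattern → Set
HasB p  = Any (λ q → Any (_⊑ p) (variants q)) (xxxx ∷ P)
Below p = Any (λ q → Any (p ⊑_) (variants q)) maximal
HasTernary p = Any (λ q → Any (_⊑ p) (variants q)) minimalTernary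
IsA p   = Any (_⊑ xyx) (variants p)

hasB? : ∀ p → Dec (HasB p)
hasB? p = Any.any? (λ q → Any.any? (_⊑? p) (variants q)) (xxxx ∷ P)
below? : ∀ p → Dec (Below p)
below? p = Any.any? (λ q → Any.any? (p ⊑?_) (variants q)) maximal
hasTernary? : ∀ p → Dec (HasTernary p)
hasTernary? p = Any.any? (λ q → Any.any? (_⊑? p) (variants q)) _
isA? : ∀ p → Dec (IsA p)
isA? p = Any.any? (_⊑? xyx) (variants p)

∈-vars : (v : Var) → v ∈ x ∷ y ∷ []
∈-vars x = here refl
∈-vars y = there (here refl)

patterns : ℕ → List Pattern
patterns = words (x ∷ y ∷ [])

module ByLength (N : ℕ) {Q Q′ : Pattern → Set}
  (short : All (All (λ p → Q p ⊎ Q′ p) ∘ patterns) (upTo N)) (long : All Q (patterns N))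
  (extend : ∀ u v → Q u → Q (u ++ v)) where

  decide : ∀ p → Q p ⊎ Q′ p
  decide p with <-≤-connex (length p) N
  ... | inj₁ l = All.lookup (All.lookup short (∈-upTo⁺ l)) (∈-words ∈-vars p)
  ... | inj₂ l = inj₁ (subst Q (take++drop≡id N p)
                   (extend (take N p) (drop N p) (All.lookup long (subst (λ n → take N p ∈ patterns n) eq (∈-words ∈-vars (take N p))))))
    where
    eq : length (take N p) ≡ N
    eq = trans (length-take N p) (m≤n⇒m⊓n≡m l)

hasB⊎below : ∀ p → HasB p ⊎ Below p
-- The longest pattern in `maximal` has length 7, so at length 8 only `HasB` can remain.
hasB⊎below = ByLength.decide 8
  (toWitness {a? = All.all? (λ n → All.all? (λ p → hasB? p ⊎-dec below? p) (patterns n)) (upTo 8)} tt)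
  (toWitness {a? = All.all? hasB? (patterns 8)} tt)
  (λ u v → Any.map (Any.map (_ⁱ++ v)))

-- Without xx and yy a pattern alternates, and from length 4 on it then contains xyxy or yxyx.
hasTernary⊎isA : ∀ p → HasTernary p ⊎ IsA p
hasTernary⊎isA = ByLength.decide 4
  (toWitness {a? = All.all? (λ n → All.all? (λ p → hasTernary? p ⊎-dec isA? p) (patterns n)) (upTo 4)} tt)
  (toWitness {a? = All.all? hasTernary? (patterns 4)} tt)
  (λ u v → Any.map (Any.map (_ⁱ++ v)))

hasB⇒condB : ∀ {p} → HasB p → CondB p
hasB⇒condB b with find b
... | q , q∈ , b′ with find b′
... | f , f∈ , f⊑p = f , ⊑⇒factor f⊑p , q , q∈ , ≈P-sym (∈-variants f∈)

isA⇒condA : ∀ {p} → IsA p → CondA p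
isA⇒condA a with find a
... | f , f∈ , f⊑ = f , ⊑⇒factor f⊑ , ∈-variants f∈

below-occurs : ∀ {p} → Below p → (w : InfWord Letter) → Occurs w p
below-occurs b w with find b
... | q , q∈ , b′ with find b′
... | f , f∈ , p⊑f = occurs-factor (⊑⇒factor p⊑f) (occ q∈ (∈-variants f∈))
  where
  occ : ∀ {q f} → q ∈ maximal → q ≈P f → Occurs w f
  occ (here refl) = occurs-≈ (xxxyy-unavoidable w) (yyxxx-unavoidable w)
  occ (there (here refl)) = occurs-≈ (xxyxy-unavoidable w) (yxyxx-unavoidable w)
  occ (there (there (here refl))) = occurs-≈ (xyxxy-unavoidable w) (yxxyx-unavoidable w)
  occ (there (there (there (here refl)))) = occurs-≈ (xyyyx-unavoidable w) (xyyyx-unavoidable w)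
  occ (there (there (there (there (here refl))))) = occurs-≈ (xxxyxxx-unavoidable w) (xxxyxxx-unavoidable w)

-- Positions and repetitions in infinite words

nth : ∀ {k} → List (Fin (suc k)) → ℕ → Fin (suc k)
nth []      _       = zero
nth (a ∷ u) zero    = a
nth (a ∷ u) (suc n) = nth u n

nth-fac : ∀ {k} (w : InfWord (Fin (suc k))) i {n j} → j < n → nth (fac w i n) j ≡ w (i + j)
nth-fac w i {suc n} {zero}  _       = cong w (sym (+-identityʳ i))
nth-fac w i {suc n} {suc j} (s≤s l) = trans (nth-fac w (suc i) l) (cong w (sym (+-suc i j)))

fac-nth : ∀ {k} (w : InfWord (Fin (suc k))) i u → (∀ j → j < length u → w (i + j) ≡ nth u j) → fac w i (length u) ≡ u
fac-nth w i []      h = refl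
fac-nth w i (a ∷ u) h = cong₂ _∷_ (trans (cong w (sym (+-identityʳ i))) (h 0 (s≤s z≤n)))
  (fac-nth w (suc i) u (λ j l → trans (cong w (sym (+-suc i j))) (h (suc j) (s≤s l))))

fac-++ : ∀ {A : Set} (w : InfWord A) i m n → fac w i (m + n) ≡ fac w i m ++ fac w (i + m) n
fac-++ w i zero    n = cong (λ j → fac w j n) (sym (+-identityʳ i))
fac-++ w i (suc m) n = cong (w i ∷_) (trans (fac-++ w (suc i) m n) (cong (λ j → fac w (suc i) m ++ fac w j n) (sym (+-suc i m))))

drop-at : ∀ {A : Set} {w : InfWord A} {u i} n → n ≤ length u → u at i within w → drop n u at i + n within w
drop-at {w = w} {u} {i} n l e = subst (λ j → drop n u at j within w) (cong (i +_) (trans (length-take n u) (m≤n⇒m⊓n≡m l)))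
  (proj₂ (++-at⁻ (take n u) (subst (_at i within w) (sym (take++drop≡id n u)) e)))

-- For l = q this is a square of period q; for l = q ∸ Γ with Γ < q it is a near-square, two equal
-- factors with Γ letters between them.
Rep : ∀ {A : Set} → InfWord A → ℕ → ℕ → ℕ → Set
Rep w i q l = ∀ j → j < l → w (i + j) ≡ w (i + q + j)

rep-mono : ∀ {A : Set} {w : InfWord A} {i q l l′} → l′ ≤ l → Rep w i q l → Rep w i q l′
rep-mono le r j lt = r j (<-≤-trans lt le)

rep⇒fac : ∀ {A : Set} {w : InfWord A} {i q} l → Rep w i q l → fac w i l ≡ fac w (i + q) l
rep⇒fac zero    r = refl
rep⇒fac {w = w} {i} {q} (suc l) r = cong₂ _∷_
  (trans (cong w (sym (+-identityʳ i))) (trans (r 0 (s≤s z≤n)) (cong w (+-identityʳ (i + q)))))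
  (rep⇒fac {i = suc i} {q} l λ j lt → trans (cong w (sym (+-suc i j))) (trans (r (suc j) (s≤s lt)) (cong w (+-suc (i + q) j))))

fac⇒rep : ∀ {k} {w : InfWord (Fin (suc k))} {i q} l → fac w i l ≡ fac w (i + q) l → Rep w i q l
fac⇒rep {w = w} {i} {q} l e j lt = trans (sym (nth-fac w i lt)) (trans (cong (λ u → nth u j) e) (nth-fac w (i + q) lt))

module _ {A : Set} where

  scan : (ℕ → List A → Bool) → ℕ → ℕ → List A → Bool
  scan Q r zero    u = true
  scan Q r (suc n) u = Q r u ∧ scan Q (suc r) n (drop 1 u)

  scan-sound : ∀ Q r n u → scan Q r n u ≡ true → ∀ {j} → j < n → Q (r + j) (drop j u) ≡ true
  scan-sound Q r (suc n) u e {zero}  _ rewrite +-identityʳ r = proj₁ (∧-true (Q r u) e)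
  scan-sound Q r (suc n) u e {suc j} (s≤s l) rewrite +-suc r j =
    subst (λ v → Q (suc (r + j)) v ≡ true) (drop-drop 1 j u) (scan-sound Q (suc r) n (drop 1 u) (proj₂ (∧-true (Q r u) e)) l)

_∈ᵇ_ : ∀ {k} → List (Fin k) → List (List (Fin k)) → Bool
u ∈ᵇ us = any (λ v → is-just (strip u v) ∧ is-just (strip v u)) us

∈ᵇ-sound : ∀ {k} (u : List (Fin k)) us → u ∈ᵇ us ≡ true → u ∈ us
∈ᵇ-sound u us e with any-true (λ v → is-just (strip u v) ∧ is-just (strip v u)) us e
... | v , v∈ , e′ with ∧-true (is-just (strip u v)) e′
... | j , j′ with is-just-true (strip u v) j | is-just-true (strip v u) j′
... | a , ea | b , eb = subst (_∈ us) (sym (prefixes a b (strip-sound u v ea) (strip-sound v u eb))) v∈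
  where
  prefixes : ∀ a b → v ≡ u ++ a → u ≡ v ++ b → u ≡ v
  prefixes a b ea eb rewrite eb with ++-cancelˡ v [] (b ++ a) (trans (++-identityʳ v) (trans ea (++-assoc v b a)))
  prefixes a [] ea eb | _ = ++-identityʳ v

-- Images under uniform substitutions

module Image {k k′ : ℕ} (K′ : ℕ) (t : InfWord (Fin (suc k))) (w : InfWord (Fin (suc k′)))
  (img : Fin (suc k) → List (Fin (suc k′))) (len : ∀ a → length (img a) ≡ suc K′)
  (image : ∀ n → w n ≡ nth (img (t (n / suc K′))) (n % suc K′)) where

  K : ℕ
  K = suc K′

  image-at : ∀ n {s} → s < K → w (n * K + s) ≡ nth (img (t n)) s
  image-at n {s} l = trans (image (n * K + s)) (cong₂ (λ q r → nth (img (t q)) r) quot rem)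
    where
    rem : (n * K + s) % K ≡ s
    rem = trans (cong (_% K) (+-comm (n * K) s)) (trans ([m+kn]%n≡m%n s n K) (m<n⇒m%n≡m l))
    quot : (n * K + s) / K ≡ n
    quot = trans (+-distrib-/-∣ˡ s (n∣m*n n)) (trans (cong₂ _+_ (m*n/n≡m n K) (m<n⇒m/n≡0 l)) (+-identityʳ n))

  fac-block : ∀ n → fac w (n * K) K ≡ img (t n)
  fac-block n = trans (cong (fac w (n * K)) (sym (len (t n))))
    (fac-nth w (n * K) (img (t n)) λ j l → image-at n (subst (j <_) (len (t n)) l))

  fac-blocks : ∀ n m → fac w (n * K) (m * K) ≡ concatMap img (fac t n m)
  fac-blocks n zero    = refl
  fac-blocks n (suc m) = trans (fac-++ w (n * K) K (m * K))
    (cong₂ _++_ (fac-block n) (trans (cong (λ i → fac w i (m * K)) (+-comm (n * K) K)) (fac-blocks (suc n) m)))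

  decompose : ∀ i → i / K * K + i % K ≡ i
  decompose i = trans (+-comm (i / K * K) (i % K)) (sym (m≡m%n+[m/n]*n i K))

  everywhere : List (List (Fin (suc k))) → (ℕ → List (Fin (suc k′)) → Bool) → Bool
  everywhere fs Q = all (λ F → scan Q 0 K (concatMap img F)) fs

  -- A start inside the first of m + 1 blocks, at offset at most K ∸ 1, leaves at least m K + 1
  -- letters. This is the origin of the bounds `suc (m * K)`.
  Window : ℕ → (ℕ → List (Fin (suc k′)) → Bool) → ℕ → Set
  Window m Q i = ∃[ u ] (u at i within w) × (m * K < length u) × (Q (i % K) u ≡ true)

  tail-at : ∀ n m {r} → r < K → let u = drop r (concatMap img (fac t n (suc m))) in
            (u at n * K + r within w) × (m * K < length u)
  tail-at n m {r} r<K = drop-at r (≤-trans (<⇒≤ r<K) (subst (K ≤_) (sym B-length) (m≤m+n K (m * K))))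
                          (trans B-fac (cong (fac w (n * K)) (sym B-length))) , long
    where
    B = concatMap img (fac t n (suc m))
    B-fac : B ≡ fac w (n * K) (suc m * K)
    B-fac = sym (fac-blocks n (suc m))
    B-length : length B ≡ suc m * K
    B-length = trans (cong length B-fac) (length-fac w (n * K) (suc m * K))
    long : m * K < length (drop r B)
    long rewrite length-drop r B | B-length = begin-strict
      m * K               ≡⟨ m+n∸m≡n K (m * K) ⟨
      K + m * K ∸ K       <⟨ ∸-monoʳ-< r<K (m≤m+n K (m * K)) ⟩
      K + m * K ∸ r       ∎
      where open ≤-Reasoning

  window : ∀ fs m Q → everywhere fs Q ≡ true → ∀ i → fac t (i / K) (suc m) ∈ fs → Window m Q i
  window fs m Q e i F∈ with tail-at (i / K) m (m%n<n i K)
  ... | at-i , long = drop (i % K) B , subst (λ j → drop (i % K) B at j within w) (decompose i) at-i , long ,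
                      scan-sound Q 0 K B (All.lookup (all-true _ fs e) F∈) (m%n<n i K)
    where
    B = concatMap img (fac t (i / K) (suc m))

  prefix-at : ∀ {u i n} → u at i within w → n ≤ length u → ∃[ v ] u ≡ fac w i n ++ v
  prefix-at {u} {i} {n} e l = at-prefix e (fac-at w i n) (subst (_≤ length u) (sym (length-fac w i n)) l)

  take-at : ∀ {u i n} → u at i within w → n ≤ length u → take n u ≡ fac w i n
  take-at {u} {i} {n} e l with prefix-at e l
  ... | v , refl = trans (cong (λ m → take m (fac w i n ++ v)) (sym (length-fac w i n))) (take-length-++ (fac w i n) v)

  absent : ℕ → ℕ → List (Fin (suc k′)) → Bool
  absent q l u = not (is-just (strip (take l u) (drop q u)))

  absent-sound : ∀ {q l u i} → u at i within w → q + l ≤ length u → absent q l u ≡ true → ¬ Rep w i q l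
  absent-sound {q} {l} {u} {i} e le ab rep with prefix-at (drop-at q (≤-trans (m≤m+n q l) le) e)
      (subst (l ≤_) (sym (length-drop q u)) (≤-trans (≤-reflexive (sym (m+n∸m≡n q l))) (∸-monoˡ-≤ q le)))
  ... | v , eq with trans (sym ab) (cong (not ∘ is-just) found)
    where
    found : strip (take l u) (drop q u) ≡ just v
    found = trans (cong₂ strip (trans (take-at e (≤-trans (m≤n+m l q) le)) (rep⇒fac l rep)) eq) (strip-++ (fac w (i + q) l) v)
  ... | ()

  -- For a period q K the shifted copy has the same offset q blocks later, so two images are scanned
  -- in parallel and the long shift is made once, on the factor of t.
  scanPeriod : ℕ → ℕ → List (Fin (suc k′)) → List (Fin (suc k′)) → Bool
  scanPeriod l zero    u v = true
  scanPeriod l (suc n) u v = not (is-just (strip (take l u) v)) ∧ scanPeriod l n (drop 1 u) (drop 1 v)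

  scanPeriod-sound : ∀ l n u v → scanPeriod l n u v ≡ true → ∀ {r} → r < n → not (is-just (strip (take l (drop r u)) (drop r v))) ≡ true
  scanPeriod-sound l (suc n) u v e {zero}  _       = proj₁ (∧-true (not (is-just (strip (take l u) v))) e)
  scanPeriod-sound l (suc n) u v e {suc r} (s≤s h) =
    subst₂ (λ a b → not (is-just (strip (take l a) b)) ≡ true) (drop-drop 1 r u) (drop-drop 1 r v)
      (scanPeriod-sound l n (drop 1 u) (drop 1 v) (proj₂ (∧-true (not (is-just (strip (take l u) v))) e)) h)

  noPeriod : List (List (Fin (suc k))) → ℕ × ℕ → Bool
  noPeriod fs (q , l) = all (λ F → scanPeriod l K (concatMap img F) (concatMap img (drop q F))) fs

  drop-fac : ∀ n q m → drop q (fac t n (q + m)) ≡ fac t (n + q) m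
  drop-fac n zero    m = cong (λ n → fac t n m) (sym (+-identityʳ n))
  drop-fac n (suc q) m = trans (drop-fac (suc n) q m) (cong (λ n → fac t n m) (sym (+-suc n q)))

  noPeriod-sound : ∀ fs q m {l} → (∀ n → fac t n (q + suc m) ∈ fs) → noPeriod fs (q , l) ≡ true → l ≤ suc (m * K) →
                   ∀ i → ¬ Rep w i (q * K) l
  noPeriod-sound fs q m {l} fs-t c le i rep = contradict
    (prefix-at (proj₁ at-v) (≤-trans le (proj₂ at-v)))
    where
    n = i / K
    r<K : i % K < K
    r<K = m%n<n i K
    u = drop (i % K) (concatMap img (fac t n (q + suc m)))
    v = drop (i % K) (concatMap img (fac t (n + q) (suc m)))
    at-v : (v at (n + q) * K + i % K within w) × (m * K < length v)
    at-v = tail-at (n + q) m r<K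
    at-u : (u at n * K + i % K within w) × ((q + m) * K < length u)
    at-u = subst (λ m′ → let u = drop (i % K) (concatMap img (fac t n m′)) in (u at n * K + i % K within w) × ((q + m) * K < length u))
      (sym (+-suc q m)) (tail-at n (q + m) r<K)
    head-u : take l u ≡ fac w i l
    head-u = trans (take-at (proj₁ at-u) (≤-trans le (≤-trans (s≤s (*-monoˡ-≤ K (m≤n+m m q))) (proj₂ at-u))))
      (cong (λ j → fac w j l) (decompose i))
    pos : (n + q) * K + i % K ≡ i + q * K
    pos = begin
      (n + q) * K + i % K         ≡⟨ cong (_+ i % K) (*-distribʳ-+ K n q) ⟩
      n * K + q * K + i % K       ≡⟨ +-assoc (n * K) (q * K) (i % K) ⟩
      n * K + (q * K + i % K)     ≡⟨ cong (n * K +_) (+-comm (q * K) (i % K)) ⟩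
      n * K + (i % K + q * K)     ≡⟨ +-assoc (n * K) (i % K) (q * K) ⟨
      n * K + i % K + q * K       ≡⟨ cong (_+ q * K) (decompose i) ⟩
      i + q * K                   ∎
      where open ≡-Reasoning
    checked : not (is-just (strip (take l u) v)) ≡ true
    checked = subst (λ F → not (is-just (strip (take l u) (drop (i % K) (concatMap img F)))) ≡ true) (drop-fac n q (suc m))
      (scanPeriod-sound l K _ _ (All.lookup (all-true _ fs c) (fs-t n)) r<K)
    contradict : ¬ (∃[ v′ ] v ≡ fac w ((n + q) * K + i % K) l ++ v′)
    contradict (v′ , eq) with trans (sym checked) (cong (not ∘ is-just)
      (trans (cong₂ strip head-u (trans eq (cong (λ j → fac w j l ++ v′) pos)))
        (trans (cong (λ a → strip a (fac w (i + q * K) l ++ v′)) (rep⇒fac l rep)) (strip-++ (fac w (i + q * K) l) v′))))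
    ... | ()

  absentAll : List (ℕ × ℕ) → ℕ → List (Fin (suc k′)) → Bool
  absentAll ql _ u = all (λ (q , l) → absent q l u) ql

  absentAll-sound : ∀ {ql q l m i} → (q , l) ∈ ql → q + l ≤ suc (m * K) → Window m (absentAll ql) i → ¬ Rep w i q l
  absentAll-sound {ql} ∈ql le (u , e , long , a) =
    absent-sound e (≤-trans le long) (All.lookup (all-true (λ (q , l) → absent q l u) ql a) ∈ql)

  refute : ∀ fs m ql → (∀ n → fac t n (suc m) ∈ fs) → everywhere fs (absentAll ql) ≡ true →
           ∀ {q l} → (q , l) ∈ ql → q + l ≤ suc (m * K) → ∀ i → ¬ Rep w i q l
  refute fs m ql fs-t c ∈ql le i = absentAll-sound {ql} {m = m} ∈ql le (window fs m (absentAll ql) c i (fs-t (i / K)))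

  -- Equal factors of length S start at positions that are congruent modulo K.
  syncWith : List (List (Fin (suc k))) → ℕ → List (Fin (suc k′)) → Bool
  syncWith fs r v = everywhere fs (λ r′ u → not (is-just (strip v u)) ∨ (r ≡ᵇ r′))

  sync : List (List (Fin (suc k))) → ℕ → ℕ → List (Fin (suc k′)) → Bool
  sync fs S r u = syncWith fs r (take S u)

  sync-sound : ∀ fs m S → (∀ n → fac t n (suc m) ∈ fs) → S ≤ suc (m * K) → everywhere fs (sync fs S) ≡ true →
               ∀ i q → Rep w i q S → i % K ≡ (i + q) % K
  sync-sound fs m S fs-t le c i q rep with window fs m (sync fs S) c i (fs-t _)
  ... | u , e , long , s with window fs m _ s (i + q) (fs-t _)
  ... | u′ , e′ , long′ , s′ with prefix-at e′ (≤-trans le long′)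
  ... | v , refl with ∨-true (not (is-just (strip (take S u) (fac w (i + q) S ++ v)))) s′
  ... | inj₁ f with trans (sym f) (cong (not ∘ is-just)
        (trans (cong (λ a → strip a (fac w (i + q) S ++ v)) (trans (take-at e (≤-trans le long)) (rep⇒fac S rep))) (strip-++ (fac w (i + q) S) v)))
  ... | ()
  sync-sound fs m S fs-t le c i q rep | u , e , long , s | u′ , e′ , long′ , s′ | v , refl | inj₂ f =
    ≡ᵇ⇒≡ (i % K) ((i + q) % K) (subst Data.Bool.T (sym f) tt)

  reversalAbsent : List (List (Fin (suc k))) → List (Fin (suc k′)) → Bool
  reversalAbsent fs v = everywhere fs (λ _ u → not (is-just (strip v u)))

  asymmetric : List (List (Fin (suc k))) → ℕ → ℕ → List (Fin (suc k′)) → Bool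
  asymmetric fs L _ u = reversalAbsent fs (reverse (take L u))

  -- Testing length L is enough: the reversal of a longer u ends with the reversal of the prefix of
  -- length L of u.
  asymmetric-sound : ∀ fs m L → (∀ n → fac t n (suc m) ∈ fs) → L ≤ suc (m * K) → everywhere fs (asymmetric fs L) ≡ true →
                     ∀ {u i j} → L ≤ length u → u at i within w → ¬ reverse u at j within w
  asymmetric-sound fs m L fs-t le c {u} {i} {j} lu e e′
    with window fs m (asymmetric fs L) c i (fs-t _) | prefix-at e lu
  ... | u₁ , e₁ , long₁ , s₁ | v , refl with subst (_at j within w) (reverse-++ (fac w i L) v) e′
  ... | e″ with ++-at⁻ (reverse v) e″
  ... | _ , e₂ with window fs m _ s₁ (j + length (reverse v)) (fs-t _)
  ... | u₃ , e₃ , long₃ , s₃ with at-prefix e₃ e₂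
        (≤-trans (≤-reflexive (trans (length-reverse (fac w i L)) (length-fac w i L))) (≤-trans le long₃))
  ... | v′ , refl with trans (sym s₃) (cong (not ∘ is-just)
        (trans (cong (λ a → strip (reverse a) (reverse (fac w i L) ++ v′)) (take-at e₁ (≤-trans le long₁))) (strip-++ (reverse (fac w i L)) v′)))
  ... | ()

  multiple : ∀ i q → i % K ≡ (i + q) % K → ∃[ q′ ] q ≡ q′ * K
  multiple i q eq = q′ , q≡
    where
    q′ = (i + q) / K ∸ i / K
    le : i / K ≤ (i + q) / K
    le = /-monoˡ-≤ K (m≤m+n i q)
    quot : (i + q) / K ≡ i / K + q′
    quot = sym (m+[n∸m]≡n le)
    q≡ : q ≡ q′ * K
    q≡ = +-cancelˡ-≡ i q (q′ * K) (begin
      i + q                                   ≡⟨ decompose (i + q) ⟨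
      (i + q) / K * K + (i + q) % K           ≡⟨ cong₂ (λ a b → a * K + b) quot (sym eq) ⟩
      (i / K + q′) * K + i % K                ≡⟨ cong (_+ i % K) (*-distribʳ-+ K (i / K) q′) ⟩
      i / K * K + q′ * K + i % K              ≡⟨ +-assoc (i / K * K) (q′ * K) (i % K) ⟩
      i / K * K + (q′ * K + i % K)            ≡⟨ cong (i / K * K +_) (+-comm (q′ * K) (i % K)) ⟩
      i / K * K + (i % K + q′ * K)            ≡⟨ +-assoc (i / K * K) (i % K) (q′ * K) ⟨
      i / K * K + i % K + q′ * K              ≡⟨ cong (_+ q′ * K) (decompose i) ⟩
      i + q′ * K                              ∎)
      where open ≡-Reasoning

  covers : List (List (Fin (suc k′))) → ℕ → ℕ → List (Fin (suc k′)) → Bool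
  covers fs m _ u = take m u ∈ᵇ fs

  covered : ∀ ps fs l m → m ≤ suc (l * K) → everywhere ps (covers fs m) ≡ true →
            ∀ i → fac t (i / K) (suc l) ∈ ps → fac w i m ∈ fs
  covered ps fs l m m≤ c i p with window ps l (covers fs m) c i p
  ... | u , e , long , e′ = subst (_∈ fs) (take-at e (≤-trans m≤ long)) (∈ᵇ-sound (take m u) fs e′)

pattern two = suc (suc zero)

rotate : Fin 3 → Fin 3
rotate O   = I
rotate I   = two
rotate two = O

-- Dejean's word

dejean₀ : List (Fin 3)
dejean₀ = O ∷ I ∷ two ∷ O ∷ two ∷ I ∷ two ∷ O ∷ I ∷ two ∷ I ∷ O ∷ two ∷ I ∷ two ∷ O ∷ two ∷ I ∷ O ∷ []

dejean : Fin 3 → List (Fin 3)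
dejean O   = dejean₀
dejean I   = map rotate dejean₀
dejean two = map (rotate ∘ rotate) dejean₀

-- The first argument is fuel. Fuel n suffices at position n, because n / 19 < n for positive n and
-- the letter at 0 is fixed by the substitution.
iterate : ℕ → ℕ → Fin 3
iterate zero    n = zero
iterate (suc f) n = nth (dejean (iterate f (n / 19))) (n % 19)

t : InfWord (Fin 3)
t n = iterate n n

iterate-zero : ∀ f → iterate f 0 ≡ zero
iterate-zero zero    = refl
iterate-zero (suc f) rewrite iterate-zero f = refl

quotient-≤ : ∀ n → suc n / 19 ≤ n
quotient-≤ n = ≤-pred (m/n<m (suc n) 19 (s≤s (s≤s z≤n)))

iterate-stable : ∀ f g n → n ≤ f → n ≤ g → iterate f n ≡ iterate g n
iterate-stable f g zero _ _ = trans (iterate-zero f) (sym (iterate-zero g))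
iterate-stable (suc f) (suc g) (suc n) (s≤s l) (s≤s l′) =
  cong (λ a → nth (dejean a) (suc n % 19)) (iterate-stable f g (suc n / 19) (≤-trans (quotient-≤ n) l) (≤-trans (quotient-≤ n) l′))

t-image : ∀ n → t n ≡ nth (dejean (t (n / 19))) (n % 19)
t-image zero    = refl
t-image (suc n) = cong (λ a → nth (dejean a) (suc n % 19)) (iterate-stable n (suc n / 19) (suc n / 19) (quotient-≤ n) ≤-refl)

dejean-length : ∀ a → length (dejean a) ≡ 19
dejean-length O   = refl
dejean-length I   = refl
dejean-length two = refl

module T = Image 18 t t dejean dejean-length t-image

pairs : List (List (Fin 3))
pairs = (O ∷ I ∷ []) ∷ (O ∷ two ∷ []) ∷ (I ∷ O ∷ []) ∷ (I ∷ two ∷ []) ∷ (two ∷ O ∷ []) ∷ (two ∷ I ∷ []) ∷ []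

collect : List (Fin 3) → List (List (Fin 3)) → List (List (Fin 3))
collect u us = add (u ∈ᵇ us)
  where
  add : Bool → List (List (Fin 3))
  add true  = us
  add false = u ∷ us

slices : ℕ → ℕ → List (Fin 3) → List (List (Fin 3))
slices zero    m u = []
slices (suc r) m u = take m u ∷ slices r m (drop 1 u)

-- All factors of length m only if m ≤ 20: these occur in the image of a factor of length 2.
factors : ℕ → List (List (Fin 3))
factors m = foldr collect [] (concatMap (λ F → slices 19 m (concatMap dejean F)) pairs)

-- Since t is its own image, the pair at n > 0 lies in the image of the pair at n / 19 < n, and
-- images of `pairs` have all their factors of length 2 in `pairs`.
fac-pairs : ∀ n → fac t n 2 ∈ pairs
fac-pairs = <-rec _ λ where
  zero    _  → here refl
  (suc n) ih → T.covered pairs pairs 1 2 (s≤s (s≤s z≤n)) refl (suc n) (ih (s≤s (quotient-≤ n)))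

abstract

  fac-factors₂ : ∀ n → fac t n 2 ∈ factors 2
  fac-factors₂ n = T.covered pairs (factors 2) 1 2 (toWitness {a? = 2 ≤? 20} tt) refl n (fac-pairs (n / 19))

  fac-factors₅ : ∀ n → fac t n 5 ∈ factors 5
  fac-factors₅ n = T.covered pairs (factors 5) 1 5 (toWitness {a? = 5 ≤? 20} tt) refl n (fac-pairs (n / 19))

  fac-factors₁₇ : ∀ n → fac t n 17 ∈ factors 17
  fac-factors₁₇ n = T.covered pairs (factors 17) 1 17 (toWitness {a? = 17 ≤? 20} tt) refl n (fac-pairs (n / 19))

-- The three blocks arise from one another by rotating the alphabet, so they differ in every column.
dejean-columns : ∀ a b (r : Fin 19) → nth (dejean a) (toℕ r) ≡ nth (dejean b) (toℕ r) → a ≡ b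
dejean-columns = toWitness {a? = Fin.all? λ a → Fin.all? λ b → Fin.all? λ (r : Fin 19) →
  (nth (dejean a) (toℕ r) Fin.≟ nth (dejean b) (toℕ r)) →-dec (a Fin.≟ b)} tt

abstract

  t-sync : ∀ i q → Rep t i q 10 → i % 19 ≡ (i + q) % 19
  t-sync = T.sync-sound pairs 1 10 fac-pairs (toWitness {a? = 10 ≤? 20} tt) refl

-- One letter determines its block by `dejean-columns`. So partly covered blocks count too: letter j
-- of t recurs as soon as the single offset j 19 lies within the repetition.
desubstitute : ∀ i q′ l {l′} → (∀ j → j < l′ → j * 19 < l) → Rep t i (q′ * 19) l → Rep t (i / 19) q′ l′
desubstitute i q′ l h rep j j<l′ = dejean-columns _ _ (fromℕ< r<19) (begin
  nth (dejean (t (i / 19 + j))) (toℕ (fromℕ< r<19))         ≡⟨ cong (nth (dejean (t (i / 19 + j)))) (Fin.toℕ-fromℕ< r<19) ⟩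
  nth (dejean (t (i / 19 + j))) r                           ≡⟨ T.image-at (i / 19 + j) r<19 ⟨
  t ((i / 19 + j) * 19 + r)                                 ≡⟨ cong t (shift j) ⟩
  t (i + j * 19)                                            ≡⟨ rep (j * 19) (h j j<l′) ⟩
  t (i + q′ * 19 + j * 19)                                  ≡⟨ cong t (trans (+-assoc i (q′ * 19) (j * 19)) (cong (i +_) (sym (*-distribʳ-+ 19 q′ j)))) ⟩
  t (i + (q′ + j) * 19)                                     ≡⟨ cong t (shift (q′ + j)) ⟨
  t ((i / 19 + (q′ + j)) * 19 + r)                          ≡⟨ cong (λ n → t (n * 19 + r)) (+-assoc (i / 19) q′ j) ⟨
  t ((i / 19 + q′ + j) * 19 + r)                            ≡⟨ T.image-at (i / 19 + q′ + j) r<19 ⟩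
  nth (dejean (t (i / 19 + q′ + j))) r                      ≡⟨ cong (nth (dejean (t (i / 19 + q′ + j)))) (Fin.toℕ-fromℕ< r<19) ⟨
  nth (dejean (t (i / 19 + q′ + j))) (toℕ (fromℕ< r<19))    ∎)
  where
  open ≡-Reasoning
  r = i % 19
  r<19 : r < 19
  r<19 = m%n<n i 19
  shift : ∀ j → (i / 19 + j) * 19 + r ≡ i + j * 19
  shift j = begin
    (i / 19 + j) * 19 + r          ≡⟨ cong (_+ r) (*-distribʳ-+ 19 (i / 19) j) ⟩
    i / 19 * 19 + j * 19 + r       ≡⟨ +-assoc (i / 19 * 19) (j * 19) r ⟩
    i / 19 * 19 + (j * 19 + r)     ≡⟨ cong (i / 19 * 19 +_) (+-comm (j * 19) r) ⟩
    i / 19 * 19 + (r + j * 19)     ≡⟨ +-assoc (i / 19 * 19) r (j * 19) ⟨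
    i / 19 * 19 + r + j * 19       ≡⟨ cong (_+ j * 19) (T.decompose i) ⟩
    i + j * 19                     ∎

-- These periods are out of reach of `t-sync`, which needs a recurring factor of length 10: squares
-- provide it from period 10 on, near-squares from period 12 on.
squares nearSquares : List (ℕ × ℕ)
squares     = map (λ q → q , q) (1 ∷ 2 ∷ 3 ∷ 4 ∷ 5 ∷ 6 ∷ 7 ∷ 8 ∷ 9 ∷ [])
nearSquares = map (λ q → q , q ∸ 2) (9 ∷ 10 ∷ 11 ∷ [])

squares-absent : ∀ {q l} → (q , l) ∈ squares → q + l ≤ 20 → ∀ i → ¬ Rep t i q l
squares-absent = T.refute pairs 1 squares fac-pairs refl

nearSquares-absent : ∀ {q l} → (q , l) ∈ nearSquares → q + l ≤ 20 → ∀ i → ¬ Rep t i q l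
nearSquares-absent = T.refute pairs 1 nearSquares fac-pairs refl

short-square : ∀ q → 0 < q → q < 10 → ∀ i → ¬ Rep t i q q
short-square (suc q) _ (s≤s l) = squares-absent (∈-map⁺ (λ q → q , q) (∈-map⁺ suc (∈-upTo⁺ l)))
  (≤-trans (+-mono-≤ l l) (toWitness {a? = 18 ≤? 20} tt))

short-nearSquare : ∀ q → 9 ≤ q → q < 12 → ∀ i → ¬ Rep t i q (q ∸ 2)
short-nearSquare q l l′ with m≤n⇒∃[o]m+o≡n l
... | o , refl = nearSquares-absent (∈-map⁺ (λ q → q , q ∸ 2) (∈-map⁺ (9 +_) (∈-upTo⁺ {3} (+-cancelˡ-< 9 o 3 l′))))
  (+-mono-≤ (≤-pred l′) (∸-monoˡ-≤ 2 (≤-pred l′)))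

abstract

  period : ∀ i q {l} → 10 ≤ l → Rep t i q l → ∃[ q′ ] q ≡ q′ * 19
  period i q 10≤l rep = T.multiple i q (t-sync i q (rep-mono {w = t} {i} {q} 10≤l rep))

squarefree : ∀ q → 0 < q → ∀ i → ¬ Rep t i q q
squarefree = <-rec _ step
  where
  step : ∀ q → (∀ {q′} → q′ < q → 0 < q′ → ∀ i → ¬ Rep t i q′ q′) → 0 < q → ∀ i → ¬ Rep t i q q
  step q ih q>0 i rep with <-≤-connex q 10
  ... | inj₁ q<10 = short-square q q>0 q<10 i rep
  ... | inj₂ 10≤q with period i q 10≤q rep
  ... | suc q′ , refl = ih (m<m*n (suc q′) 19 (s≤s (s≤s z≤n))) (s≤s z≤n) (i / 19)
                          (desubstitute i (suc q′) (suc q′ * 19) (λ j → *-monoˡ-< 19) rep)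
  step .0 ih () i rep | inj₂ 10≤q | zero , refl

-- The bound 9 is sharp: t contains 7/4-powers of period 8.
no-near-square : ∀ q → 9 ≤ q → ∀ i → ¬ Rep t i q (q ∸ 2)
no-near-square q 9≤q i rep with <-≤-connex q 12
... | inj₁ q<12 = short-nearSquare q 9≤q q<12 i rep
... | inj₂ 12≤q with period i q (∸-monoˡ-≤ 2 12≤q) rep
... | suc q′ , refl = squarefree (suc q′) (s≤s z≤n) (i / 19)
                        (desubstitute i (suc q′) (suc q′ * 19 ∸ 2) bound rep)
  where
  -- Even two letters short of its period, the repetition reaches each of the `suc q′` blocks, so a
  -- near-square desubstitutes to a full square.
  bound : ∀ j → j < suc q′ → j * 19 < suc q′ * 19 ∸ 2
  bound j (s≤s l) = s≤s (≤-trans (*-monoˡ-≤ 19 l) (m≤n+m (q′ * 19) 16))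
no-near-square .0 () i rep | inj₂ 12≤q | zero , refl

-- Images of Dejean's word

module Bounds {k} (w : InfWord (Fin (suc k))) (L Γ Q : ℕ) (L≤Q : L ≤ Q)
  (asym : ∀ {u i j} → L ≤ length u → u at i within w → ¬ reverse u at j within w)
  (near : ∀ i q → Q ≤ q → ¬ Rep w i q (q ∸ Γ)) where

  near-block : ∀ {B i q} → B at i within w → B at i + q within w → Q ≤ q → q ≤ length B + Γ → ⊥
  near-block {B} {i} {q} e e′ Q≤q q≤ = near i q Q≤q
    (rep-mono {w = w} {i} {q} (≤-trans (∸-monoˡ-≤ Γ q≤) (≤-reflexive (m+n∸n≡m (length B) Γ)))
      (fac⇒rep (length B) (trans (sym e) e′)))

  oriented : ∀ {X B B′ i j} → X ≃ B → X ≃ B′ → L ≤ length X → B at i within w → B′ at j within w → B ≡ B′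
  oriented (inj₁ refl) (inj₁ refl) l e e′ = refl
  oriented (inj₁ refl) (inj₂ refl) l e e′ = ⊥-elim (asym l e e′)
  oriented (inj₂ refl) (inj₁ refl) l e e′ = ⊥-elim (asym l e′ e)
  oriented (inj₂ refl) (inj₂ refl) l e e′ = refl

  -- Two blocks of v that are long enough to be equal, with at most Γ letters between them, form a
  -- near-square of period at most `length B + Γ`.
  gap : ∀ {R v p i} mid → Match w R (v ∷ mid ++ v ∷ p) i → size R mid ≤ Γ → length (R v) < Q
  gap {R} {v} {p} {i} mid (block B r e m) g with <-≤-connex (length (R v)) Q | match-++⁻ mid m
  ... | inj₁ l | _ = l
  ... | inj₂ Q≤ | _ , block B′ r′ e′ _ with oriented r r′ (≤-trans L≤Q Q≤) e e′
  ... | refl = ⊥-elim (near-block {B} e (subst (B at_within w) (+-assoc i (length B) (size R mid)) e′)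
      (≤-trans Q≤ (≤-trans (≤-reflexive (sym (≃-length r))) (m≤m+n _ _))) (+-monoʳ-≤ (length B) g))

  square : ∀ {R v p i} → Match w R (v ∷ v ∷ p) i → length (R v) < Q
  square m = gap [] m z≤n

  -- If both blocks have length at least L, each variable keeps its orientation and vuvu is a
  -- square. Otherwise the block shorter than L ≤ Γ is the gap of a near-square formed by the other.
  alternating : ∀ {R v u p i} → L ≤ Γ → Match w R (v ∷ u ∷ v ∷ u ∷ p) i → (length (R v) < Q) × (length (R u) < Q)
  alternating {R} {v} {u} {p} {i} L≤Γ m@(block B r e m₁@(block C s f (block B′ r′ e′ (block C′ s′ f′ _)))) = boundˡ , boundʳ
    where
    long : L ≤ length (R v) → L ≤ length (R u) → Q ≤ length (R v) + length (R u) → ⊥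
    long lv lu Q≤ with oriented r r′ lv e e′ | oriented s s′ lu f f′
    ... | refl | refl = near-block {B ++ C} (++-at⁺ B e f) (subst (B ++ C at_within w) pos (++-at⁺ B e′ f′))
        (subst₂ (λ a b → Q ≤ a + b) (sym (≃-length r)) (sym (≃-length s)) Q≤)
        (≤-trans (≤-reflexive (sym (length-++ B))) (m≤m+n _ Γ))
      where
      pos : i + length B + length C ≡ i + (length B + length C)
      pos = +-assoc i (length B) (length C)
    single : ∀ u → L ≤ Γ → length (R u) < L → size R (u ∷ []) ≤ Γ
    single u L≤Γ l = subst (_≤ Γ) (sym (+-identityʳ _)) (≤-trans (<⇒≤ l) L≤Γ)
    boundˡ : length (R v) < Q
    boundˡ with <-≤-connex (length (R v)) Q | <-≤-connex (length (R u)) L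
    ... | inj₁ l | _       = l
    ... | inj₂ Q≤ | inj₁ l = gap (u ∷ []) m (single u L≤Γ l)
    ... | inj₂ Q≤ | inj₂ l = ⊥-elim (long (≤-trans L≤Q Q≤) l (≤-trans Q≤ (m≤m+n _ _)))
    boundʳ : length (R u) < Q
    boundʳ with <-≤-connex (length (R u)) Q | <-≤-connex (length (R v)) L
    ... | inj₁ l | _       = l
    ... | inj₂ Q≤ | inj₁ l = gap (v ∷ []) m₁ (single v L≤Γ l)
    ... | inj₂ Q≤ | inj₂ l = ⊥-elim (long l (≤-trans L≤Q Q≤) (≤-trans Q≤ (m≤n+m _ _)))

weight : ℕ → ℕ → Pattern → ℕ
weight a b []      = 0
weight a b (x ∷ p) = a + weight a b p
weight a b (y ∷ p) = b + weight a b p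

size≤weight : ∀ {A : Set} {R : Var → List A} {a b} → length (R x) ≤ a → length (R y) ≤ b → ∀ p → size R p ≤ weight a b p
size≤weight la lb []      = z≤n
size≤weight la lb (x ∷ p) = +-mono-≤ la (size≤weight la lb p)
size≤weight la lb (y ∷ p) = +-mono-≤ lb (size≤weight la lb p)

allowed-< : ∀ {n j} → j < n → Allowed (allowed n) j
allowed-< {suc n} {zero}  _       = refl
allowed-< {suc n} {suc j} (s≤s l) = allowed-< l

listed : ∀ {k} {U : List (Fin k)} {n} → U ≢ [] → length U ≤ n → Listed (allowed n) U
listed {U = []}    ne l = ⊥-elim (ne refl)
listed {U = _ ∷ U} ne l = length U , allowed-< l , refl

between : ℕ → ℕ → List Bool
between zero    a       = allowed a
between (suc n) zero    = []
between (suc n) (suc a) = false ∷ between n a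

between-< : ∀ n {a j} → n ≤ j → j < a → Allowed (between n a) j
between-< zero    _       l       = allowed-< l
between-< (suc n) (s≤s h) (s≤s l) = between-< n h l

-- L: factors of this length do not occur reversed. S: factors of this length synchronise.
-- Q, Γ: no factor of length q ∸ Γ reoccurs at distance q ≥ Q. The periods q K with q ≤ 8 are inspected on factors of t
-- of length 17; for q ≥ 9 they would give a near-square of t.
module Word (t : InfWord (Fin 3)) (fs₂ fs₅ fs₁₇ : List (List (Fin 3)))
  (fac₂ : ∀ n → fac t n 2 ∈ fs₂) (fac₅ : ∀ n → fac t n 5 ∈ fs₅) (fac₁₇ : ∀ n → fac t n 17 ∈ fs₁₇)
  (t-near : ∀ q → 9 ≤ q → ∀ i → ¬ Rep t i q (q ∸ 2))
  (k′ K′ : ℕ) (sub : Fin 3 → Vec (Fin (suc k′)) (suc K′)) (L Γ S Q : ℕ) where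

  img : Fin 3 → List (Fin (suc k′))
  img = toList ∘ sub

  w : InfWord (Fin (suc k′))
  w n = nth (img (t (n / suc K′))) (n % suc K′)

  open Image K′ t w img (length-toList ∘ sub) (λ _ → refl) public

  -- The periods Q ≤ q < S + Γ, for which q ∸ Γ falls short of the synchronising length S; all
  -- longer ones are multiples of K.
  nearList : List (ℕ × ℕ)
  nearList  = map (λ o → Q + o , Q + o ∸ Γ) (upTo (S + Γ ∸ Q))

  multiples : List ℕ
  multiples = map suc (upTo 8)

  multiplesCheckAt : ℕ → Bool
  multiplesCheckAt q = noPeriod fs₁₇ (q , q * K ∸ Γ)

  record Valid : Set where
    field
      L≤Q        : True (L ≤? Q)
      Q>0        : True (0 <? Q)
      Γ≤K        : True (Γ ≤? K)
      L≤         : True (L ≤? suc (1 * K))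
      S≤         : True (S ≤? suc (1 * K))
      S+Γ≤       : True (S + Γ + (S + Γ) ≤? suc (4 * K))
      injective  : True (Fin.all? λ a → Fin.all? λ b → ≡-dec Fin._≟_ (img a) (img b) →-dec (a Fin.≟ b))
      asymCheck  : everywhere fs₂ (asymmetric fs₂ L) ≡ true
      syncCheck  : everywhere fs₂ (sync fs₂ S) ≡ true
      nearCheck  : everywhere fs₅ (absentAll nearList) ≡ true
      multCheck  : all multiplesCheckAt multiples ≡ true

  -- Full blocks number n + 1, ..., n + q′ ∸ 2 lie in the factor of length q′ K ∸ Γ.
  block-rep : Γ ≤ K → (∀ a b → img a ≡ img b → a ≡ b) → ∀ i q′ → Rep w i (q′ * K) (q′ * K ∸ Γ) → Rep t (suc (i / K)) q′ (q′ ∸ 2)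
  block-rep Γ≤K inj i q′ rep j j< = inj _ _ (begin
    img (t (suc n + j))                 ≡⟨ fac-block (suc n + j) ⟨
    fac w ((suc n + j) * K) K           ≡⟨ rep⇒fac K blockRep ⟩
    fac w ((suc n + j) * K + q′ * K) K  ≡⟨ cong (λ a → fac w a K) (trans (sym (*-distribʳ-+ K (suc n + j) q′)) (cong (_* K) reorder)) ⟩
    fac w ((suc n + q′ + j) * K) K      ≡⟨ fac-block (suc n + q′ + j) ⟩
    img (t (suc n + q′ + j))            ∎)
    where
    open ≡-Reasoning
    n = i / K
    r = i % K
    reorder : suc n + j + q′ ≡ suc n + q′ + j
    reorder = trans (+-assoc (suc n) j q′) (trans (cong (suc n +_) (+-comm j q′)) (sym (+-assoc (suc n) q′ j)))
    d : ℕ → ℕ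
    d s = (K ∸ r) + (j * K + s)
    offset : ∀ s → (suc n + j) * K + s ≡ i + d s
    offset s = begin
      (suc n + j) * K + s                    ≡⟨ cong (_+ s) (*-distribʳ-+ K (suc n) j) ⟩
      K + n * K + j * K + s                  ≡⟨ +-assoc (K + n * K) (j * K) s ⟩
      K + n * K + (j * K + s)                ≡⟨ cong (_+ (j * K + s)) (+-comm K (n * K)) ⟩
      n * K + K + (j * K + s)                ≡⟨ cong (λ a → n * K + a + (j * K + s)) (m+[n∸m]≡n (<⇒≤ (m%n<n i K))) ⟨
      n * K + (r + (K ∸ r)) + (j * K + s)    ≡⟨ cong (_+ (j * K + s)) (+-assoc (n * K) r (K ∸ r)) ⟨
      n * K + r + (K ∸ r) + (j * K + s)      ≡⟨ cong (λ a → a + (K ∸ r) + (j * K + s)) (decompose i) ⟩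
      i + (K ∸ r) + (j * K + s)              ≡⟨ +-assoc i (K ∸ r) (j * K + s) ⟩
      i + d s                                ∎
    short : ∀ s → s < K → d s < q′ * K ∸ Γ
    -- One K bounds the partial first block and (j + 1) K the full blocks up to the current one; j +
    -- 3 ≤ q′ leaves another K, which absorbs Γ.
    short s s<K = ≤-trans (≤-trans (+-mono-<-≤′ s<K) lem) (∸-monoʳ-≤ (q′ * K) Γ≤K)
      where
      +-mono-<-≤′ : s < K → suc (d s) ≤ K + (j * K + K)
      +-mono-<-≤′ l = ≤-trans (≤-reflexive (sym (+-suc (K ∸ r) (j * K + s))))
        (+-mono-≤ (m∸n≤m K r) (≤-trans (≤-reflexive (sym (+-suc (j * K) s))) (+-monoʳ-≤ (j * K) l)))
      j+3≤q′ : 3 + j ≤ q′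
      j+3≤q′ = ≤-trans (≤-reflexive (+-comm 2 (suc j))) (≤-trans (+-monoˡ-≤ 2 j<)
        (≤-reflexive (m∸n+n≡m {q′} {2} (<⇒≤ (m∸n≢0⇒n<m {q′} {2} λ z → <⇒≱ j< (subst (_≤ j) (sym z) z≤n))))))
      lem : K + (j * K + K) ≤ q′ * K ∸ K
      lem = ≤-trans (≤-reflexive (cong (K +_) (+-comm (j * K) K)))
        (≤-trans (≤-reflexive (sym (m+n∸m≡n K (K + (K + j * K))))) (∸-monoˡ-≤ K (*-monoˡ-≤ K j+3≤q′)))
    blockRep : Rep w ((suc n + j) * K) (q′ * K) K
    blockRep s s<K = begin
      w ((suc n + j) * K + s)              ≡⟨ cong w (offset s) ⟩
      w (i + d s)                          ≡⟨ rep (d s) (short s s<K) ⟩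
      w (i + q′ * K + d s)                 ≡⟨ cong w (trans (+-assoc i _ _) (trans (cong (i +_) (+-comm (q′ * K) (d s))) (sym (+-assoc i _ _)))) ⟩
      w (i + d s + q′ * K)                 ≡⟨ cong (λ a → w (a + q′ * K)) (offset s) ⟨
      w ((suc n + j) * K + s + q′ * K)     ≡⟨ cong w (trans (+-assoc ((suc n + j) * K) _ _) (trans (cong ((suc n + j) * K +_) (+-comm s (q′ * K))) (sym (+-assoc ((suc n + j) * K) _ _)))) ⟩
      w ((suc n + j) * K + q′ * K + s)     ∎

  module Facts (valid : Valid) where
    open Valid valid

    asym : ∀ {u i j} → L ≤ length u → u at i within w → ¬ reverse u at j within w
    asym = asymmetric-sound fs₂ 1 L fac₂ (toWitness L≤) asymCheck

    near-multiple : ∀ i q′ → 0 < q′ → ¬ Rep w i (q′ * K) (q′ * K ∸ Γ)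
    near-multiple i (suc q) _ rep with <-≤-connex (suc q) 9
    -- Seventeen blocks hold two periods of up to 8 blocks, and one block more because the factor
    -- may start inside a block.
    ... | inj₁ (s≤s q<8) = noPeriod-sound fs₁₇ (suc q) (15 ∸ q)
          (λ n → subst (λ m → fac t n m ∈ fs₁₇) (sym factor-length) (fac₁₇ n))
          (All.lookup (all-true multiplesCheckAt multiples multCheck) (∈-map⁺ suc (∈-upTo⁺ q<8)))
          (≤-trans (m∸n≤m (suc q * K) Γ) (≤-trans (*-monoˡ-≤ K (≤-trans q<8 (m+n≤o⇒m≤o∸n 8 (+-monoʳ-≤ 8 (≤-pred q<8))))) (n≤1+n _))) i rep
      where
      factor-length : suc q + suc (15 ∸ q) ≡ 17
      factor-length = cong suc (trans (+-suc q (15 ∸ q)) (cong suc (m+[n∸m]≡n (≤-trans (≤-pred q<8) (m≤m+n 7 8)))))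
    ... | inj₂ 9≤ = t-near (suc q) 9≤ (suc (i / K)) (block-rep (toWitness Γ≤K) (toWitness injective) i (suc q) rep)

    near : ∀ i q → Q ≤ q → ¬ Rep w i q (q ∸ Γ)
    near i q Q≤q rep with <-≤-connex q (S + Γ)
    ... | inj₁ q< with m≤n⇒∃[o]m+o≡n Q≤q
    ... | o , refl = refute fs₅ 4 nearList fac₅ nearCheck
          (∈-map⁺ (λ o → Q + o , Q + o ∸ Γ) (∈-upTo⁺ (+-cancelˡ-< Q o _ (<-≤-trans q< (m≤n+m∸n (S + Γ) Q)))))
          (≤-trans (+-mono-≤ (<⇒≤ q<) (≤-trans (m∸n≤m _ Γ) (<⇒≤ q<))) (toWitness S+Γ≤)) i rep
    near i q Q≤q rep | inj₂ q≥ with multiple i q (sync-sound fs₂ 1 S fac₂ (toWitness S≤) syncCheck i q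
                                      (rep-mono {w = w} {i} {q} (≤-trans (≤-reflexive (sym (m+n∸n≡m S Γ))) (∸-monoˡ-≤ Γ q≥)) rep))
    ... | zero   , refl = <⇒≱ (toWitness Q>0) Q≤q
    ... | suc q′ , refl = near-multiple i (suc q′) (s≤s z≤n) rep

    open Bounds w L Γ Q (toWitness L≤Q) asym near public

    noMatch : List Bool → List Bool → Pattern → ℕ → List (Fin (suc k′)) → Bool
    noMatch bx by p _ u = not (search bx by p none none u)

    avoid : ∀ bx by p a b → everywhere fs₅ (noMatch bx by p) ≡ true → True (weight a b p ≤? suc (4 * K)) →
            ∀ {R i} → Match w R p i → Listed bx (R x) → Listed by (R y) → length (R x) ≤ a → length (R y) ≤ b → ⊥
    avoid bx by p a b c fits {R} {i} m hx hy la lb with window fs₅ 4 (noMatch bx by p) c i (fac₅ (i / K))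
    ... | u , e , long , s with trans (sym s) (cong not (search-complete hx hy m none none u tt tt e
          (≤-trans (size≤weight {R = R} la lb p) (≤-trans (toWitness fits) long))))
    ... | ()

    avoidBounded : ∀ p a b → everywhere fs₅ (noMatch (allowed a) (allowed b) p) ≡ true → True (weight a b p ≤? suc (4 * K)) →
                   (∀ {R i} → Match w R p i → (length (R x) < suc a) × (length (R y) < suc b)) → ¬ Occurs w p
    avoidBounded p a b c fits bounds (R , ne , i , m) with bounds m
    ... | s≤s la , s≤s lb = avoid (allowed a) (allowed b) p a b c fits m (listed (ne x) la) (listed (ne y) lb) la lb

    -- Sharpens the bound from `square`: lengths n + 1 to a are excluded by search, so that xx or
    -- xxx becomes short enough to be a gap between two blocks of y. With n = 0 it excludes p
    -- altogether.
    rootBound : ∀ p n a → All (x ≡_) p → everywhere fs₅ (noMatch (between n a) (between n a) p) ≡ true →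
                True (weight a a p ≤? suc (4 * K)) → ∀ {R i} → Match w R p i → length (R x) < suc a → length (R x) ≤ n
    rootBound p n a xs c fits {R} {i} m (s≤s la) with ≤-<-connex (length (R x)) n
    ... | inj₁ l = l
    ... | inj₂ l with m≤n⇒∃[o]m+o≡n l
    -- The search treats two variables; y, absent from p, borrows the representative of x.
    ... | o , eq = ⊥-elim (avoid (between n a) (between n a) p a a c fits {R = λ _ → R x} (match-only refl xs m) root root la la)
      where
      root : Listed (between n a) (R x)
      root = n + o , between-< n (m≤m+n n o) (subst (_≤ a) (sym eq) la) , sym eq

-- Avoiding words for xxxx, the patterns of P, xyxy and xx

OccurrenceFree : ℕ → Pattern → Set
OccurrenceFree k p = Σ[ w ∈ InfWord (Fin k) ] ¬ Occurs w p

dropMatch : ∀ {A : Set} {w : InfWord A} {R} a {q i} → Match w R (a ++ q) i → Match w R q (i + size R a)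
dropMatch a m = proj₂ (match-++⁻ a m)

nonzero : ∀ {A : Set} {U : List A} → U ≢ [] → ¬ length U ≤ 0
nonzero {U = []} ne z≤n = ne refl

module DejeanImage = Word t (factors 2) (factors 5) (factors 17) fac-factors₂ fac-factors₅ fac-factors₁₇ no-near-square

-- The blocks are return words found in long words that avoid the pattern.
block₁ : Fin 3 → Vec (Fin 2) 42
block₁ O   = I ∷ O ∷ I ∷ I ∷ I ∷ O ∷ O ∷ O ∷ I ∷ I ∷ O ∷ O ∷ I ∷ I ∷ I ∷ O ∷ O ∷ O ∷ I ∷ I ∷ O ∷ I ∷ I ∷ I ∷ O ∷ O ∷ O ∷ I ∷ I ∷ O ∷ I ∷ I ∷ I ∷ O ∷ I ∷ I ∷ I ∷ O ∷ O ∷ O ∷ I ∷ O ∷ []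
block₁ I   = I ∷ O ∷ I ∷ I ∷ I ∷ O ∷ O ∷ O ∷ I ∷ O ∷ I ∷ O ∷ I ∷ I ∷ I ∷ O ∷ O ∷ O ∷ I ∷ O ∷ O ∷ O ∷ I ∷ O ∷ O ∷ I ∷ I ∷ I ∷ O ∷ O ∷ O ∷ I ∷ I ∷ O ∷ I ∷ I ∷ I ∷ O ∷ O ∷ O ∷ I ∷ O ∷ []
block₁ two = I ∷ O ∷ I ∷ I ∷ I ∷ O ∷ O ∷ O ∷ I ∷ O ∷ I ∷ O ∷ I ∷ I ∷ I ∷ O ∷ O ∷ O ∷ I ∷ I ∷ O ∷ O ∷ I ∷ I ∷ I ∷ O ∷ O ∷ O ∷ I ∷ O ∷ O ∷ I ∷ I ∷ I ∷ O ∷ O ∷ O ∷ I ∷ I ∷ O ∷ I ∷ I ∷ []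

-- The last four arguments are L, Γ, S, Q. Here and below, Γ = 0 if every variable is squared, Γ = L
-- if the bounds come from `alternating`, and otherwise Γ is at least the length of the xx or xxx
-- between two blocks of y.
module W₁ = DejeanImage 1 41 block₁ 10 0 33 11

abstract
  valid₁ : W₁.Valid
  valid₁ = record
    { L≤Q = tt ; Q>0 = tt ; Γ≤K = tt ; L≤ = tt ; S≤ = tt ; S+Γ≤ = tt ; injective = tt
    ; asymCheck = refl ; syncCheck = refl ; nearCheck = refl ; multCheck = refl }

module F₁ = W₁.Facts valid₁

abstract

  xxxx-avoidable : OccurrenceFree 2 (x ∷ x ∷ x ∷ x ∷ [])
  xxxx-avoidable = W₁.w , λ (R , ne , i , m) → nonzero (ne x) (F₁.rootBound (x ∷ x ∷ x ∷ x ∷ []) 0 10 (refl ∷ refl ∷ refl ∷ refl ∷ []) refl tt m (F₁.square m))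

  xxyxyy-avoidable : OccurrenceFree 2 (x ∷ x ∷ y ∷ x ∷ y ∷ y ∷ [])
  xxyxyy-avoidable = W₁.w , F₁.avoidBounded (x ∷ x ∷ y ∷ x ∷ y ∷ y ∷ []) 10 10 refl tt
    (λ m → F₁.square m , F₁.square (dropMatch (x ∷ x ∷ y ∷ x ∷ []) m))

  yyxyxx-avoidable : OccurrenceFree 2 (y ∷ y ∷ x ∷ y ∷ x ∷ x ∷ [])
  yyxyxx-avoidable = W₁.w , F₁.avoidBounded (y ∷ y ∷ x ∷ y ∷ x ∷ x ∷ []) 10 10 refl tt
    (λ m → F₁.square (dropMatch (y ∷ y ∷ x ∷ y ∷ []) m) , F₁.square m)

block₂ : Fin 3 → Vec (Fin 2) 25
block₂ O   = O ∷ O ∷ O ∷ I ∷ I ∷ O ∷ I ∷ I ∷ O ∷ O ∷ I ∷ O ∷ O ∷ I ∷ I ∷ I ∷ I ∷ O ∷ I ∷ I ∷ I ∷ O ∷ I ∷ O ∷ O ∷ []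
block₂ I   = O ∷ O ∷ O ∷ I ∷ I ∷ O ∷ I ∷ I ∷ I ∷ O ∷ O ∷ I ∷ O ∷ O ∷ O ∷ I ∷ I ∷ O ∷ I ∷ I ∷ I ∷ I ∷ I ∷ O ∷ I ∷ []
block₂ two = O ∷ O ∷ O ∷ I ∷ I ∷ O ∷ I ∷ I ∷ I ∷ I ∷ I ∷ O ∷ I ∷ O ∷ O ∷ O ∷ I ∷ I ∷ O ∷ I ∷ I ∷ I ∷ O ∷ O ∷ I ∷ []

module W₂ = DejeanImage 1 24 block₂ 10 10 25 16

abstract
  valid₂ : W₂.Valid
  valid₂ = record
    { L≤Q = tt ; Q>0 = tt ; Γ≤K = tt ; L≤ = tt ; S≤ = tt ; S+Γ≤ = tt ; injective = tt
    ; asymCheck = refl ; syncCheck = refl ; nearCheck = refl ; multCheck = refl }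

module F₂ = W₂.Facts valid₂

abstract

  xxxyyy-avoidable : OccurrenceFree 2 (x ∷ x ∷ x ∷ y ∷ y ∷ y ∷ [])
  xxxyyy-avoidable = W₂.w , F₂.avoidBounded (x ∷ x ∷ x ∷ y ∷ y ∷ y ∷ []) 15 15 refl tt
    (λ m → F₂.square m , F₂.square (dropMatch (x ∷ x ∷ x ∷ []) m))

  yyyxxx-avoidable : OccurrenceFree 2 (y ∷ y ∷ y ∷ x ∷ x ∷ x ∷ [])
  yyyxxx-avoidable = W₂.w , F₂.avoidBounded (y ∷ y ∷ y ∷ x ∷ x ∷ x ∷ []) 15 15 refl tt
    (λ m → F₂.square (dropMatch (y ∷ y ∷ y ∷ []) m) , F₂.square m)

  xyxyyx-avoidable : OccurrenceFree 2 (x ∷ y ∷ x ∷ y ∷ y ∷ x ∷ [])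
  xyxyyx-avoidable = W₂.w , F₂.avoidBounded (x ∷ y ∷ x ∷ y ∷ y ∷ x ∷ []) 15 15 refl tt
    (λ m → F₂.alternating (toWitness {a? = 10 ≤? 10} tt) m)

  xyyxyx-avoidable : OccurrenceFree 2 (x ∷ y ∷ y ∷ x ∷ y ∷ x ∷ [])
  xyyxyx-avoidable = W₂.w , F₂.avoidBounded (x ∷ y ∷ y ∷ x ∷ y ∷ x ∷ []) 15 15 refl tt
    (λ m → swap (F₂.alternating (toWitness {a? = 10 ≤? 10} tt) (dropMatch (x ∷ y ∷ []) m)))

block₃ : Fin 3 → Vec (Fin 2) 24
block₃ O   = O ∷ O ∷ O ∷ I ∷ I ∷ O ∷ I ∷ O ∷ O ∷ O ∷ I ∷ I ∷ I ∷ I ∷ O ∷ O ∷ I ∷ O ∷ I ∷ I ∷ I ∷ I ∷ I ∷ O ∷ []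
block₃ I   = O ∷ O ∷ O ∷ I ∷ I ∷ O ∷ I ∷ O ∷ O ∷ I ∷ I ∷ O ∷ O ∷ O ∷ O ∷ O ∷ I ∷ I ∷ I ∷ I ∷ O ∷ I ∷ O ∷ O ∷ []
block₃ two = O ∷ O ∷ O ∷ I ∷ I ∷ O ∷ I ∷ O ∷ I ∷ I ∷ I ∷ I ∷ I ∷ O ∷ O ∷ I ∷ I ∷ O ∷ I ∷ O ∷ O ∷ I ∷ I ∷ I ∷ []

module W₃ = DejeanImage 1 23 block₃ 10 13 11 19

abstract
  valid₃ : W₃.Valid
  valid₃ = record
    { L≤Q = tt ; Q>0 = tt ; Γ≤K = tt ; L≤ = tt ; S≤ = tt ; S+Γ≤ = tt ; injective = tt
    ; asymCheck = refl ; syncCheck = refl ; nearCheck = refl ; multCheck = refl }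

module F₃ = W₃.Facts valid₃

abstract

  -- Then xx spans at most 8 letters, within the slack Γ = 13, and two blocks of y around it form a
  -- near-square.
  xx-root₃ : ∀ {R i} → Match W₃.w R (x ∷ x ∷ []) i → length (R x) ≤ 4
  xx-root₃ m = F₃.rootBound (x ∷ x ∷ []) 4 18 (refl ∷ refl ∷ []) refl tt m (F₃.square m)

  xxyxxy-avoidable : OccurrenceFree 2 (x ∷ x ∷ y ∷ x ∷ x ∷ y ∷ [])
  xxyxxy-avoidable = W₃.w , F₃.avoidBounded (x ∷ x ∷ y ∷ x ∷ x ∷ y ∷ []) 4 18 refl tt λ {R} m →
    let l = xx-root₃ (proj₁ (match-++⁻ (x ∷ x ∷ []) m)) in
    s≤s l , F₃.gap (x ∷ x ∷ []) (dropMatch (x ∷ x ∷ []) m) (≤-trans (size≤weight {R = R} l ≤-refl (x ∷ x ∷ [])) (toWitness {a? = 8 ≤? 13} tt))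

  yxxyxx-avoidable : OccurrenceFree 2 (y ∷ x ∷ x ∷ y ∷ x ∷ x ∷ [])
  yxxyxx-avoidable = W₃.w , F₃.avoidBounded (y ∷ x ∷ x ∷ y ∷ x ∷ x ∷ []) 4 18 refl tt λ {R} m →
    let l = xx-root₃ (proj₁ (match-++⁻ (x ∷ x ∷ []) (dropMatch (y ∷ []) m))) in
    s≤s l , F₃.gap (x ∷ x ∷ []) m (≤-trans (size≤weight {R = R} l ≤-refl (x ∷ x ∷ [])) (toWitness {a? = 8 ≤? 13} tt))

  xyxxyx-avoidable : OccurrenceFree 2 (x ∷ y ∷ x ∷ x ∷ y ∷ x ∷ [])
  xyxxyx-avoidable = W₃.w , F₃.avoidBounded (x ∷ y ∷ x ∷ x ∷ y ∷ x ∷ []) 4 18 refl tt λ {R} m →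
    let l = xx-root₃ (proj₁ (match-++⁻ (x ∷ x ∷ []) (dropMatch (x ∷ y ∷ []) m))) in
    s≤s l , F₃.gap (x ∷ x ∷ []) (dropMatch (x ∷ []) m) (≤-trans (size≤weight {R = R} l ≤-refl (x ∷ x ∷ [])) (toWitness {a? = 8 ≤? 13} tt))

block₄ : Fin 3 → Vec (Fin 2) 38
block₄ O   = O ∷ O ∷ I ∷ O ∷ I ∷ O ∷ I ∷ I ∷ O ∷ O ∷ O ∷ O ∷ I ∷ I ∷ I ∷ I ∷ O ∷ O ∷ I ∷ I ∷ O ∷ I ∷ I ∷ I ∷ O ∷ O ∷ O ∷ I ∷ O ∷ O ∷ I ∷ I ∷ O ∷ O ∷ O ∷ I ∷ I ∷ I ∷ []
block₄ I   = O ∷ O ∷ I ∷ O ∷ I ∷ O ∷ I ∷ I ∷ O ∷ O ∷ O ∷ I ∷ I ∷ I ∷ O ∷ O ∷ I ∷ O ∷ I ∷ I ∷ O ∷ O ∷ O ∷ O ∷ I ∷ I ∷ I ∷ O ∷ O ∷ I ∷ I ∷ O ∷ O ∷ O ∷ I ∷ I ∷ I ∷ I ∷ []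
block₄ two = O ∷ O ∷ I ∷ O ∷ I ∷ O ∷ I ∷ I ∷ O ∷ O ∷ O ∷ I ∷ I ∷ I ∷ O ∷ O ∷ I ∷ I ∷ O ∷ I ∷ I ∷ I ∷ O ∷ O ∷ O ∷ I ∷ O ∷ O ∷ I ∷ I ∷ O ∷ O ∷ O ∷ O ∷ I ∷ I ∷ I ∷ I ∷ []

module W₄ = DejeanImage 1 37 block₄ 9 9 23 17

abstract
  valid₄ : W₄.Valid
  valid₄ = record
    { L≤Q = tt ; Q>0 = tt ; Γ≤K = tt ; L≤ = tt ; S≤ = tt ; S+Γ≤ = tt ; injective = tt
    ; asymCheck = refl ; syncCheck = refl ; nearCheck = refl ; multCheck = refl }

module F₄ = W₄.Facts valid₄

abstract

  xxxyxy-avoidable : OccurrenceFree 2 (x ∷ x ∷ x ∷ y ∷ x ∷ y ∷ [])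
  xxxyxy-avoidable = W₄.w , F₄.avoidBounded (x ∷ x ∷ x ∷ y ∷ x ∷ y ∷ []) 16 16 refl tt
    (λ m → F₄.alternating (toWitness {a? = 9 ≤? 9} tt) (dropMatch (x ∷ x ∷ []) m))

  yxyxxx-avoidable : OccurrenceFree 2 (y ∷ x ∷ y ∷ x ∷ x ∷ x ∷ [])
  yxyxxx-avoidable = W₄.w , F₄.avoidBounded (y ∷ x ∷ y ∷ x ∷ x ∷ x ∷ []) 16 16 refl tt
    (λ m → swap (F₄.alternating (toWitness {a? = 9 ≤? 9} tt) m))

block₅ : Fin 3 → Vec (Fin 2) 32
block₅ O   = O ∷ O ∷ O ∷ O ∷ O ∷ I ∷ I ∷ I ∷ O ∷ I ∷ O ∷ O ∷ O ∷ I ∷ I ∷ I ∷ O ∷ I ∷ O ∷ I ∷ O ∷ O ∷ O ∷ I ∷ I ∷ I ∷ O ∷ I ∷ O ∷ O ∷ O ∷ I ∷ []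
block₅ I   = O ∷ O ∷ O ∷ O ∷ O ∷ I ∷ I ∷ I ∷ I ∷ I ∷ O ∷ I ∷ O ∷ O ∷ I ∷ I ∷ O ∷ I ∷ O ∷ O ∷ O ∷ I ∷ I ∷ I ∷ I ∷ I ∷ O ∷ I ∷ I ∷ I ∷ O ∷ I ∷ []
block₅ two = O ∷ O ∷ O ∷ O ∷ O ∷ I ∷ I ∷ I ∷ I ∷ I ∷ O ∷ I ∷ O ∷ O ∷ O ∷ I ∷ O ∷ O ∷ O ∷ O ∷ O ∷ I ∷ I ∷ I ∷ O ∷ I ∷ O ∷ O ∷ I ∷ I ∷ O ∷ I ∷ []

module W₅ = DejeanImage 1 31 block₅ 8 0 18 17

abstract
  valid₅ : W₅.Valid
  valid₅ = record
    { L≤Q = tt ; Q>0 = tt ; Γ≤K = tt ; L≤ = tt ; S≤ = tt ; S+Γ≤ = tt ; injective = tt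
    ; asymCheck = refl ; syncCheck = refl ; nearCheck = refl ; multCheck = refl }

module F₅ = W₅.Facts valid₅

abstract

  xxxyyx-avoidable : OccurrenceFree 2 (x ∷ x ∷ x ∷ y ∷ y ∷ x ∷ [])
  xxxyyx-avoidable = W₅.w , F₅.avoidBounded (x ∷ x ∷ x ∷ y ∷ y ∷ x ∷ []) 16 16 refl tt
    (λ m → F₅.square m , F₅.square (dropMatch (x ∷ x ∷ x ∷ []) m))

  xyyxxx-avoidable : OccurrenceFree 2 (x ∷ y ∷ y ∷ x ∷ x ∷ x ∷ [])
  xyyxxx-avoidable = W₅.w , F₅.avoidBounded (x ∷ y ∷ y ∷ x ∷ x ∷ x ∷ []) 16 16 refl tt
    (λ m → F₅.square (dropMatch (x ∷ y ∷ y ∷ []) m) , F₅.square (dropMatch (x ∷ []) m))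

block₆ : Fin 3 → Vec (Fin 2) 28
block₆ O   = O ∷ O ∷ O ∷ O ∷ I ∷ I ∷ I ∷ I ∷ I ∷ O ∷ I ∷ I ∷ O ∷ I ∷ O ∷ O ∷ O ∷ O ∷ I ∷ I ∷ I ∷ I ∷ I ∷ O ∷ I ∷ I ∷ O ∷ I ∷ []
block₆ I   = O ∷ O ∷ O ∷ O ∷ I ∷ I ∷ I ∷ I ∷ O ∷ I ∷ O ∷ O ∷ O ∷ I ∷ O ∷ O ∷ O ∷ O ∷ I ∷ I ∷ I ∷ I ∷ O ∷ I ∷ I ∷ I ∷ O ∷ I ∷ []
block₆ two = O ∷ O ∷ O ∷ O ∷ I ∷ I ∷ I ∷ I ∷ O ∷ I ∷ I ∷ I ∷ O ∷ I ∷ O ∷ O ∷ I ∷ O ∷ O ∷ O ∷ O ∷ O ∷ I ∷ I ∷ I ∷ I ∷ O ∷ I ∷ []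

module W₆ = DejeanImage 1 27 block₆ 9 0 27 15

abstract
  valid₆ : W₆.Valid
  valid₆ = record
    { L≤Q = tt ; Q>0 = tt ; Γ≤K = tt ; L≤ = tt ; S≤ = tt ; S+Γ≤ = tt ; injective = tt
    ; asymCheck = refl ; syncCheck = refl ; nearCheck = refl ; multCheck = refl }

module F₆ = W₆.Facts valid₆

abstract

  xxyyyx-avoidable : OccurrenceFree 2 (x ∷ x ∷ y ∷ y ∷ y ∷ x ∷ [])
  xxyyyx-avoidable = W₆.w , F₆.avoidBounded (x ∷ x ∷ y ∷ y ∷ y ∷ x ∷ []) 14 14 refl tt
    (λ m → F₆.square m , F₆.square (dropMatch (x ∷ x ∷ []) m))

  xyyyxx-avoidable : OccurrenceFree 2 (x ∷ y ∷ y ∷ y ∷ x ∷ x ∷ [])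
  xyyyxx-avoidable = W₆.w , F₆.avoidBounded (x ∷ y ∷ y ∷ y ∷ x ∷ x ∷ []) 14 14 refl tt
    (λ m → F₆.square (dropMatch (x ∷ y ∷ y ∷ y ∷ []) m) , F₆.square (dropMatch (x ∷ []) m))

block₇ : Fin 3 → Vec (Fin 2) 41
block₇ O   = O ∷ O ∷ O ∷ O ∷ I ∷ I ∷ I ∷ I ∷ O ∷ I ∷ O ∷ O ∷ I ∷ O ∷ O ∷ I ∷ I ∷ O ∷ I ∷ I ∷ O ∷ I ∷ O ∷ O ∷ O ∷ O ∷ I ∷ I ∷ O ∷ O ∷ I ∷ I ∷ I ∷ I ∷ O ∷ I ∷ O ∷ I ∷ I ∷ O ∷ I ∷ []
block₇ I   = O ∷ O ∷ O ∷ O ∷ I ∷ I ∷ I ∷ I ∷ O ∷ I ∷ O ∷ O ∷ I ∷ O ∷ I ∷ O ∷ O ∷ O ∷ O ∷ I ∷ I ∷ O ∷ I ∷ O ∷ I ∷ O ∷ O ∷ I ∷ I ∷ I ∷ I ∷ O ∷ I ∷ O ∷ I ∷ I ∷ O ∷ O ∷ I ∷ O ∷ I ∷ []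
block₇ two = O ∷ O ∷ O ∷ O ∷ I ∷ I ∷ I ∷ I ∷ O ∷ I ∷ O ∷ O ∷ I ∷ O ∷ I ∷ O ∷ O ∷ O ∷ O ∷ I ∷ I ∷ O ∷ I ∷ I ∷ O ∷ I ∷ O ∷ O ∷ I ∷ O ∷ O ∷ I ∷ I ∷ I ∷ I ∷ O ∷ I ∷ O ∷ I ∷ O ∷ I ∷ []

module W₇ = DejeanImage 1 40 block₇ 9 12 14 20

abstract
  valid₇ : W₇.Valid
  valid₇ = record
    { L≤Q = tt ; Q>0 = tt ; Γ≤K = tt ; L≤ = tt ; S≤ = tt ; S+Γ≤ = tt ; injective = tt
    ; asymCheck = refl ; syncCheck = refl ; nearCheck = refl ; multCheck = refl }

module F₇ = W₇.Facts valid₇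

abstract

  -- Three blocks of length at most 4 span at most 12 letters, which is exactly the slack Γ of this
  -- word.
  xxx-root₇ : ∀ {R i} → Match W₇.w R (x ∷ x ∷ x ∷ []) i → length (R x) ≤ 4
  xxx-root₇ m = F₇.rootBound (x ∷ x ∷ x ∷ []) 4 19 (refl ∷ refl ∷ refl ∷ []) refl tt m (F₇.square m)

  xyxxxy-avoidable : OccurrenceFree 2 (x ∷ y ∷ x ∷ x ∷ x ∷ y ∷ [])
  xyxxxy-avoidable = W₇.w , F₇.avoidBounded (x ∷ y ∷ x ∷ x ∷ x ∷ y ∷ []) 4 19 refl tt λ {R} m →
    let l = xxx-root₇ (proj₁ (match-++⁻ (x ∷ x ∷ x ∷ []) (dropMatch (x ∷ y ∷ []) m))) in
    s≤s l , F₇.gap (x ∷ x ∷ x ∷ []) (dropMatch (x ∷ []) m) (≤-trans (size≤weight {R = R} l ≤-refl (x ∷ x ∷ x ∷ [])) (toWitness {a? = 12 ≤? 12} tt))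

  yxxxyx-avoidable : OccurrenceFree 2 (y ∷ x ∷ x ∷ x ∷ y ∷ x ∷ [])
  yxxxyx-avoidable = W₇.w , F₇.avoidBounded (y ∷ x ∷ x ∷ x ∷ y ∷ x ∷ []) 4 19 refl tt λ {R} m →
    let l = xxx-root₇ (proj₁ (match-++⁻ (x ∷ x ∷ x ∷ []) (dropMatch (y ∷ []) m))) in
    s≤s l , F₇.gap (x ∷ x ∷ x ∷ []) m (≤-trans (size≤weight {R = R} l ≤-refl (x ∷ x ∷ x ∷ [])) (toWitness {a? = 12 ≤? 12} tt))

block₈ : Fin 3 → Vec (Fin 2) 40
block₈ O   = O ∷ O ∷ I ∷ O ∷ I ∷ I ∷ I ∷ O ∷ O ∷ O ∷ O ∷ I ∷ O ∷ O ∷ O ∷ I ∷ I ∷ I ∷ I ∷ O ∷ I ∷ I ∷ O ∷ I ∷ O ∷ O ∷ O ∷ I ∷ I ∷ I ∷ I ∷ O ∷ I ∷ I ∷ I ∷ O ∷ O ∷ O ∷ O ∷ I ∷ []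
block₈ I   = O ∷ O ∷ I ∷ O ∷ I ∷ I ∷ I ∷ O ∷ O ∷ O ∷ I ∷ I ∷ O ∷ I ∷ I ∷ I ∷ O ∷ O ∷ O ∷ I ∷ I ∷ O ∷ I ∷ O ∷ O ∷ O ∷ I ∷ I ∷ I ∷ O ∷ O ∷ O ∷ O ∷ I ∷ O ∷ O ∷ O ∷ I ∷ I ∷ I ∷ []
block₈ two = O ∷ O ∷ I ∷ O ∷ I ∷ I ∷ I ∷ O ∷ O ∷ O ∷ I ∷ I ∷ I ∷ I ∷ O ∷ I ∷ I ∷ I ∷ O ∷ O ∷ O ∷ I ∷ I ∷ O ∷ I ∷ O ∷ O ∷ O ∷ I ∷ I ∷ I ∷ O ∷ O ∷ I ∷ O ∷ O ∷ O ∷ I ∷ I ∷ I ∷ []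

module W₈ = DejeanImage 1 39 block₈ 10 0 22 13

abstract
  valid₈ : W₈.Valid
  valid₈ = record
    { L≤Q = tt ; Q>0 = tt ; Γ≤K = tt ; L≤ = tt ; S≤ = tt ; S+Γ≤ = tt ; injective = tt
    ; asymCheck = refl ; syncCheck = refl ; nearCheck = refl ; multCheck = refl }

module F₈ = W₈.Facts valid₈

abstract

  xyyxx-avoidable : OccurrenceFree 2 (x ∷ y ∷ y ∷ x ∷ x ∷ [])
  xyyxx-avoidable = W₈.w , F₈.avoidBounded (x ∷ y ∷ y ∷ x ∷ x ∷ []) 12 12 refl tt
    (λ m → F₈.square (dropMatch (x ∷ y ∷ y ∷ []) m) , F₈.square (dropMatch (x ∷ []) m))

-- The blocks of `block₈` reversed. The blocks of `dejean` are palindromes, so the factors of t are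
-- closed under reversal, and the factors of this word are the reversals of those of `W₈.w`.
blockᴿ : Fin 3 → Vec (Fin 2) 40
blockᴿ O   = I ∷ O ∷ O ∷ O ∷ O ∷ I ∷ I ∷ I ∷ O ∷ I ∷ I ∷ I ∷ I ∷ O ∷ O ∷ O ∷ I ∷ O ∷ I ∷ I ∷ O ∷ I ∷ I ∷ I ∷ I ∷ O ∷ O ∷ O ∷ I ∷ O ∷ O ∷ O ∷ O ∷ I ∷ I ∷ I ∷ O ∷ I ∷ O ∷ O ∷ []
blockᴿ I   = I ∷ I ∷ I ∷ O ∷ O ∷ O ∷ I ∷ O ∷ O ∷ O ∷ O ∷ I ∷ I ∷ I ∷ O ∷ O ∷ O ∷ I ∷ O ∷ I ∷ I ∷ O ∷ O ∷ O ∷ I ∷ I ∷ I ∷ O ∷ I ∷ I ∷ O ∷ O ∷ O ∷ I ∷ I ∷ I ∷ O ∷ I ∷ O ∷ O ∷ []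
blockᴿ two = I ∷ I ∷ I ∷ O ∷ O ∷ O ∷ I ∷ O ∷ O ∷ I ∷ I ∷ I ∷ O ∷ O ∷ O ∷ I ∷ O ∷ I ∷ I ∷ O ∷ O ∷ O ∷ I ∷ I ∷ I ∷ O ∷ I ∷ I ∷ I ∷ I ∷ O ∷ O ∷ O ∷ I ∷ I ∷ I ∷ O ∷ I ∷ O ∷ O ∷ []

module Wᴿ = DejeanImage 1 39 blockᴿ 10 0 22 13

abstract
  validᴿ : Wᴿ.Valid
  validᴿ = record
    { L≤Q = tt ; Q>0 = tt ; Γ≤K = tt ; L≤ = tt ; S≤ = tt ; S+Γ≤ = tt ; injective = tt
    ; asymCheck = refl ; syncCheck = refl ; nearCheck = refl ; multCheck = refl }

module Fᴿ = Wᴿ.Facts validᴿ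

abstract

  xxyyx-avoidable : OccurrenceFree 2 (x ∷ x ∷ y ∷ y ∷ x ∷ [])
  xxyyx-avoidable = Wᴿ.w , Fᴿ.avoidBounded (x ∷ x ∷ y ∷ y ∷ x ∷ []) 12 12 refl tt
    (λ m → Fᴿ.square m , Fᴿ.square (dropMatch (x ∷ x ∷ []) m))

block₉ : Fin 3 → Vec (Fin 2) 26
block₉ O   = O ∷ O ∷ O ∷ O ∷ I ∷ O ∷ O ∷ I ∷ I ∷ O ∷ I ∷ O ∷ O ∷ O ∷ O ∷ I ∷ O ∷ O ∷ I ∷ I ∷ I ∷ O ∷ O ∷ O ∷ I ∷ I ∷ []
block₉ I   = O ∷ O ∷ O ∷ O ∷ I ∷ O ∷ O ∷ I ∷ I ∷ I ∷ O ∷ I ∷ O ∷ O ∷ O ∷ I ∷ I ∷ I ∷ I ∷ O ∷ I ∷ O ∷ O ∷ I ∷ I ∷ I ∷ []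
block₉ two = O ∷ O ∷ O ∷ O ∷ I ∷ O ∷ O ∷ I ∷ I ∷ I ∷ I ∷ O ∷ I ∷ O ∷ O ∷ O ∷ I ∷ I ∷ O ∷ I ∷ O ∷ O ∷ I ∷ I ∷ I ∷ I ∷ []

module W₉ = DejeanImage 1 25 block₉ 9 9 13 19

abstract
  valid₉ : W₉.Valid
  valid₉ = record
    { L≤Q = tt ; Q>0 = tt ; Γ≤K = tt ; L≤ = tt ; S≤ = tt ; S+Γ≤ = tt ; injective = tt
    ; asymCheck = refl ; syncCheck = refl ; nearCheck = refl ; multCheck = refl }

module F₉ = W₉.Facts valid₉

abstract

  xyxyx-avoidable : OccurrenceFree 2 (x ∷ y ∷ x ∷ y ∷ x ∷ [])
  xyxyx-avoidable = W₉.w , F₉.avoidBounded (x ∷ y ∷ x ∷ y ∷ x ∷ []) 18 18 refl tt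
    (λ m → F₉.alternating (toWitness {a? = 9 ≤? 9} tt) m)

blockᵀ : Fin 3 → Vec (Fin 3) 26
blockᵀ O   = I ∷ two ∷ two ∷ O ∷ O ∷ O ∷ I ∷ O ∷ two ∷ I ∷ I ∷ I ∷ O ∷ I ∷ two ∷ O ∷ two ∷ two ∷ two ∷ I ∷ I ∷ I ∷ O ∷ I ∷ two ∷ I ∷ []
blockᵀ I   = I ∷ two ∷ two ∷ O ∷ O ∷ O ∷ I ∷ I ∷ O ∷ two ∷ O ∷ O ∷ two ∷ I ∷ two ∷ two ∷ I ∷ O ∷ two ∷ O ∷ O ∷ O ∷ I ∷ O ∷ two ∷ I ∷ []
blockᵀ two = I ∷ two ∷ two ∷ O ∷ O ∷ O ∷ I ∷ I ∷ two ∷ two ∷ I ∷ O ∷ O ∷ two ∷ two ∷ O ∷ I ∷ I ∷ two ∷ O ∷ O ∷ O ∷ I ∷ O ∷ two ∷ I ∷ []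

module Wᵀ = DejeanImage 2 25 blockᵀ 5 5 10 11

abstract
  validᵀ : Wᵀ.Valid
  validᵀ = record
    { L≤Q = tt ; Q>0 = tt ; Γ≤K = tt ; L≤ = tt ; S≤ = tt ; S+Γ≤ = tt ; injective = tt
    ; asymCheck = refl ; syncCheck = refl ; nearCheck = refl ; multCheck = refl }

module Fᵀ = Wᵀ.Facts validᵀ

abstract

  xyxy-avoidable : OccurrenceFree 3 (x ∷ y ∷ x ∷ y ∷ [])
  xyxy-avoidable = Wᵀ.w , Fᵀ.avoidBounded (x ∷ y ∷ x ∷ y ∷ []) 10 10 refl tt
    (λ m → Fᵀ.alternating (toWitness {a? = 5 ≤? 5} tt) m)

ternary-square-free : ¬ Occurs t (x ∷ x ∷ [])
ternary-square-free (R , ne , i , block B r e (block B′ r′ e′ [])) with ≃-trans (≃-sym r) r′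
... | inj₁ refl = squarefree (length B) (nonempty-block r) i (fac⇒rep (length B) (trans (sym e) e′))
  where
  nonempty-block : ∀ {C} → R x ≃ C → 0 < length C
  nonempty-block s with R x | ne x | ≃-length s
  ... | []    | n | _ = ⊥-elim (n refl)
  ... | _ ∷ _ | _ | l = subst (0 <_) (sym l) (s≤s z≤n)
... | inj₂ refl = no-mirror (reverse B) refl
  where
  -- XXᴿ has a squared letter in its middle.
  no-mirror : ∀ C → reverse B ≡ C → ⊥
  no-mirror []      eq = ne x (empty (R x) r (trans (sym (reverse-involutive B)) (cong reverse eq)))
    where
    empty : ∀ U → U ≃ B → B ≡ [] → U ≡ []
    empty []      _ _    = refl
    empty (_ ∷ _) s refl with () ← ≃-length s
  no-mirror (c ∷ C) eq = squarefree 1 (s≤s z≤n) j (λ { zero _ → letters-equal ; (suc _) (s≤s ()) })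
    where
    j = i + length (reverse C)
    B≡ : B ≡ reverse C ++ c ∷ []
    B≡ = trans (sym (reverse-involutive B)) (trans (cong reverse eq) (unfold-reverse c C))
    middle : c ∷ c ∷ C at j within t
    middle = proj₂ (++-at⁻ (reverse C) (subst (_at i within t)
      (trans (cong₂ _++_ B≡ eq) (++-assoc (reverse C) (c ∷ []) (c ∷ C))) (++-at⁺ B e e′)))
    letters-equal : t (j + 0) ≡ t (j + 1 + 0)
    letters-equal = begin
      t (j + 0)      ≡⟨ cong t (+-identityʳ j) ⟩
      t j            ≡⟨ ∷-injectiveˡ middle ⟨
      c              ≡⟨ ∷-injectiveˡ (∷-injectiveʳ middle) ⟩
      t (suc j)      ≡⟨ cong t (trans (+-identityʳ (j + 1)) (+-comm j 1)) ⟨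
      t (j + 1 + 0)  ∎
      where open ≡-Reasoning

-- From occurrences to the avoidability index

avoids-≈ : ∀ {k q f} → OccurrenceFree k q → OccurrenceFree k (reverse q) → q ≈P f → OccurrenceFree k f
avoids-≈ a a′ (inj₁ refl) = a
avoids-≈ {q = q} (w , a) a′ (inj₂ (inj₁ refl)) = w , a ∘ occurs-bar q
avoids-≈ a a′ (inj₂ (inj₂ (inj₁ refl))) = a′
avoids-≈ {q = q} a (w , a′) (inj₂ (inj₂ (inj₂ refl))) =
  w , a′ ∘ occurs-bar (reverse q) ∘ subst (Occurs w) (reverse-bar q)

avoidable-factor : ∀ {k f p} → IsFactor f p → OccurrenceFree k f → AvoidableOver k p
avoidable-factor fac (w , a) = w , a ∘ occurs-factor fac ∘ encounters⇒occurs

binary : All (λ q → OccurrenceFree 2 q × OccurrenceFree 2 (reverse q)) (xxxx ∷ P)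
binary = (xxxx-avoidable   , xxxx-avoidable)
       ∷ (xxyyx-avoidable  , xyyxx-avoidable)
       ∷ (xyxyx-avoidable  , xyxyx-avoidable)
       ∷ (xxxyxy-avoidable , yxyxxx-avoidable)
       ∷ (xxxyyx-avoidable , xyyxxx-avoidable)
       ∷ (xxxyyy-avoidable , yyyxxx-avoidable)
       ∷ (xxyxxy-avoidable , yxxyxx-avoidable)
       ∷ (xxyxyy-avoidable , yyxyxx-avoidable)
       ∷ (xxyyyx-avoidable , xyyyxx-avoidable)
       ∷ (xyxxxy-avoidable , yxxxyx-avoidable)
       ∷ (xyxxyx-avoidable , xyxxyx-avoidable)
       ∷ (xyxyyx-avoidable , xyyxyx-avoidable)
       ∷ []

ternary : All (λ q → OccurrenceFree 3 q × OccurrenceFree 3 (reverse q)) minimalTernary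
ternary = ((t , ternary-square-free) , (t , ternary-square-free))
        ∷ (xyxy-avoidable , proj₁ xyxy-avoidable , proj₂ xyxy-avoidable ∘ occurs-bar (x ∷ y ∷ x ∷ y ∷ []))
        ∷ []

condB-avoidable : ∀ {p} → CondB p → AvoidableOver 2 p
condB-avoidable (f , fac , q , q∈ , f≈q) with All.lookup binary q∈
... | a , a′ = avoidable-factor fac (avoids-≈ a a′ (≈P-sym f≈q))

hasTernary-avoidable : ∀ {p} → HasTernary p → AvoidableOver 3 p
hasTernary-avoidable h with find h
... | q , q∈ , h′ with find h′ | All.lookup ternary q∈
... | f , f∈ , f⊑p | a , a′ = avoidable-factor (⊑⇒factor f⊑p) (avoids-≈ a a′ (∈-variants f∈))

unavoidable₁ : ∀ p → ¬ AvoidableOver 1 p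
unavoidable₁ p (w , a) = a (occurs⇒encounters (unary-occurs w p))

theorem9 : (p : Pattern)
    → (CondA p → LambdaIs p nothing)
    × (CondB p → LambdaIs p (just 2))
    × (¬ CondA p → ¬ CondB p → LambdaIs p (just 3))
theorem9 p = infinite , two-letters , three-letters
  where
  infinite : CondA p → LambdaIs p nothing
  infinite a k _ (w , av) = av (occurs⇒encounters (condA-occurs a w))

  two-letters : CondB p → LambdaIs p (just 2)
  two-letters b = s≤s z≤n , condB-avoidable b , λ where
    1 _ _ → unavoidable₁ p
    0 () _
    (suc (suc _)) _ (s≤s (s≤s ()))

  three-letters : ¬ CondA p → ¬ CondB p → LambdaIs p (just 3)
  three-letters ¬a ¬b = s≤s z≤n , avoidable (hasTernary⊎isA p) , λ where
      0 () _
      1 _ _ → unavoidable₁ p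
      2 _ _ (w , av) → av (occurs⇒encounters (below-occurs (below (hasB⊎below p)) w))
      (suc (suc (suc _))) _ (s≤s (s≤s (s≤s ())))
    where
    avoidable : HasTernary p ⊎ IsA p → AvoidableOver 3 p
    avoidable (inj₁ h) = hasTernary-avoidable h
    avoidable (inj₂ a) = ⊥-elim (¬a (isA⇒condA a))
    below : HasB p ⊎ Below p → Below p
    below (inj₁ b) = ⊥-elim (¬b (hasB⇒condB b))
    below (inj₂ b) = b
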